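{- (a) There exists $g_0$ such that every $5$-regular graph $G$ with girth at least $g_0$ satisfies $\gamma_t(G)\le \frac{4}{11}|V(G)|$. (b) A uniformly random labelled $5$-regular graph $G$ on $n$ vertices ($n$ even) asymptotically almost surely, as $n\to\infty$, satisfies $\gamma_t(G)\le\frac{4}{11}n$.
   Context: Graphs are finite and simple. A total dominating set of a graph $G=(V,E)$ is a set $S\subseteq V$ such that every vertex $v\in V$ is adjacent to a vertex of $S$; $\gamma_t(G)$ is the minimum size of a total dominating set of $G$. The girth of a graph is the length of its shortest cycle. An event holds asymptotically almost surely if its probability tends to $1$ as $n\to\infty$. -}

module Defs where

open import Data.Fin using (Fin; zero; suc; inject₁; fromℕ)
open import Data.Fin.Properties using (all?; any?)
open import Data.Fin.Subset
  using (Subset; inside; outside; ∣_∣; ⊤; _∈_; _∉_)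
open import Data.Fin.Subset.Properties using (_∈?_; ∣⊤∣≡n; ∈⊤)
open import Data.Integer using (+_)
open import Data.List
  using (List; []; _∷_; length; map; filter; mapMaybe; cartesianProductWith)
open import Data.List.Extrema.Nat using (min; argmin-sel; min≤xs)
open import Data.List.Membership.Propositional using () renaming (_∈_ to _∈ˡ_)
open import Data.List.Membership.Propositional.Properties
  using (∈-cartesianProductWith⁺; ∈-filter⁺; ∈-filter⁻; ∈-map⁺; ∈-map⁻)
import Data.List.Relation.Unary.All as All
open import Data.List.Relation.Unary.Any using (here; there)
open import Data.Maybe using (Maybe) renaming (map to mapᴹ)
open import Data.Nat using (ℕ; zero; suc; _≤_; _≥_; _≟_)
open import Data.Nat.Divisibility using (_∣_)
open import Data.Product using (∃-syntax; _×_; _,_; uncurry)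
open import Data.Rational using (ℚ; 0ℚ; _/_)
import Data.Rational as ℚ
open import Data.Sum using (inj₁; inj₂)
open import Data.Vec using (Vec; []; _∷_; lookup)
open import Function using (id; Injective)
open import Relation.Binary.PropositionalEquality
  using (_≡_; refl; sym; trans)
open import Relation.Nullary using (Dec; ¬?)
open import Relation.Nullary.Decidable using (_×-dec_; _→-dec_; dec⇒maybe)
open import Relation.Unary using (Decidable)

private variable
  A : Set
  n : ℕ

-- Row v of an adjacency matrix is the neighbourhood of v.  Vectors are used
-- rather than functions so that a labelled graph is first-order data which
-- can be enumerated without function extensionality.
AdjMatrix : ℕ → Set
AdjMatrix n = Vec (Subset n) n

IsSymmetric IsLoopless : AdjMatrix n → Set
IsSymmetric M = ∀ u v → v ∈ lookup M u → u ∈ lookup M v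
IsLoopless  M = ∀ v → v ∉ lookup M v

record Graph (n : ℕ) : Set where
  constructor mkGraph
  field
    matrix    : AdjMatrix n
    symmetric : IsSymmetric matrix
    loopless  : IsLoopless matrix

  neighbours : Fin n → Subset n
  neighbours = lookup matrix

  Adjacent : Fin n → Fin n → Set
  Adjacent u v = v ∈ neighbours u

  degree : Fin n → ℕ
  degree v = ∣ neighbours v ∣

open Graph public

Regular : ℕ → Graph n → Set
Regular d G = ∀ v → degree G v ≡ d

regular? : ∀ d → Decidable (Regular {n} d)
regular? d G = all? (λ v → degree G v ≟ d)

-- A cycle of length k; the vertices are listed in cyclic order.
data Cycle (G : Graph n) : ℕ → Set where
  cycle : ∀ {m} → 2 ≤ m →
          (c : Fin (suc m) → Fin n) → Injective _≡_ _≡_ c →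
          (∀ (i : Fin m) → Adjacent G (c (inject₁ i)) (c (suc i))) →
          Adjacent G (c (fromℕ m)) (c zero) →
          Cycle G (suc m)

IsGirth : Graph n → ℕ → Set
IsGirth G k = Cycle G k × (∀ l → Cycle G l → k ≤ l)

-- A graph without cycles has no numerical girth; as usual its girth is then
-- infinite, so it satisfies every lower bound.
GirthAtLeast : Graph n → ℕ → Set
GirthAtLeast G g = ∀ k → IsGirth G k → g ≤ k

TotalDominating : Graph n → Subset n → Set
TotalDominating G S = ∀ v → ∃[ u ] (u ∈ S × Adjacent G v u)

totalDominating? : (G : Graph n) → Decidable (TotalDominating G)
totalDominating? G S =
  all? λ v → any? λ u → (u ∈? S) ×-dec (u ∈? neighbours G v)

allVecs : List A → ∀ n → List (Vec A n)
allVecs xs zero    = [] ∷ []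
allVecs xs (suc n) = cartesianProductWith _∷_ xs (allVecs xs n)

allSubsets : ∀ n → List (Subset n)
allSubsets = allVecs (outside ∷ inside ∷ [])

-- The first argument n of min is the size of the whole vertex set.  The whole
-- vertex set is total dominating whenever any set is, so it only matters as a
-- default value for graphs with an isolated vertex, which have no total
-- dominating set; see γₜ-attained and γₜ-minimal below.
γₜ : Graph n → ℕ
γₜ {n} G = min n (map ∣_∣ (filter (totalDominating? G) (allSubsets n)))

∈-allVecs : {xs : List A} → (∀ x → x ∈ˡ xs) → (v : Vec A n) → v ∈ˡ allVecs xs n
∈-allVecs all∈ []      = here refl
∈-allVecs all∈ (x ∷ v) =
  ∈-cartesianProductWith⁺ _∷_ (all∈ x) (∈-allVecs all∈ v)

∈-allSubsets : (S : Subset n) → S ∈ˡ allSubsets n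
∈-allSubsets = ∈-allVecs λ where
  outside → here refl
  inside  → there (here refl)

γₜ-minimal : (G : Graph n) (S : Subset n) → TotalDominating G S → γₜ G ≤ ∣ S ∣
γₜ-minimal {n} G S td = All.lookup (min≤xs n _)
  (∈-map⁺ ∣_∣ (∈-filter⁺ (totalDominating? G) (∈-allSubsets S) td))

γₜ-attained : (G : Graph n) → (∃[ S ] TotalDominating G S) →
              ∃[ S ] (TotalDominating G S × ∣ S ∣ ≡ γₜ G)
γₜ-attained {n} G (S , td)
  with argmin-sel id n (map ∣_∣ (filter (totalDominating? G) (allSubsets n)))
... | inj₁ γ≡n = ⊤ , whole , trans (∣⊤∣≡n n) (sym γ≡n)
  where
  whole : TotalDominating G ⊤
  whole v = let (u , _ , vu) = td v in u , ∈⊤ , vu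
... | inj₂ γ∈ with ∈-map⁻ ∣_∣ γ∈
...   | T , T∈ , γ≡∣T∣ with ∈-filter⁻ (totalDominating? G) {xs = allSubsets n} T∈
...     | _ , td′ = T , td′ , sym γ≡∣T∣

isSimple? : (M : AdjMatrix n) → Dec (IsSymmetric M × IsLoopless M)
isSimple? M =
  (all? λ u → all? λ v → (v ∈? lookup M u) →-dec (u ∈? lookup M v))
  ×-dec (all? λ v → ¬? (v ∈? lookup M v))

-- Each simple adjacency matrix, i.e. each labelled graph, contributes exactly
-- one entry.
allGraphs : ∀ n → List (Graph n)
allGraphs n = mapMaybe toGraph (allVecs (allSubsets n) n)
  where
  toGraph : AdjMatrix n → Maybe (Graph n)
  toGraph M = mapᴹ (uncurry (mkGraph M)) (dec⇒maybe (isSimple? M))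

regularGraphs : ℕ → ∀ n → List (Graph n)
regularGraphs d n = filter (regular? d) (allGraphs n)

-- Probability of P for a uniformly random entry of the list.  The value on the
-- empty list, where no uniform distribution exists, is 0, so that a claim of
-- high probability is never vacuous.
uniformProb : List A → {P : A → Set} → Decidable P → ℚ
uniformProb []          P? = 0ℚ
uniformProb xs@(_ ∷ _)  P? = + length (filter P? xs) / length xs

-- Convergence along the even integers.
_⟶ᵉᵛᵉⁿ_ : (ℕ → ℚ) → ℚ → Set
p ⟶ᵉᵛᵉⁿ q = ∀ (ε : ℚ) → 0ℚ ℚ.< ε →
  ∃[ N ] ∀ n → n ≥ N → 2 ∣ n → ℚ.∣ p n ℚ.- q ∣ ℚ.< ε

-- Give every vertex an independent random label and run a greedy process in
-- three rounds: in round i, a vertex labelled i enters the set if enough of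
-- its neighbours are still uncovered, i.e. not adjacent to a vertex that
-- entered in an earlier round.  Afterwards every uncovered vertex adds one of
-- its neighbours.  If no short cycle is near v then the parts of the process
-- seen through different branches at v depend on disjoint sets of labels, so
-- the expected contribution of v to the size of the set is an explicit
-- rational number below 9/25 < 4/11.  Hence 25 γₜ ≤ 9 n + C X for every
-- 5-regular graph, where X counts the short cycles.
--
-- If the girth is large, X = 0.  For random graphs, replace the last edge uv
-- of a k-cycle and another edge ab by ua and vb.  A k-cycle allows at least n
-- such switchings, while every graph arises from O(n) of them, as the
-- remaining path and the edges ua, vb determine the switching.  So X is O(1)
-- on average, and by Markov's inequality it is o(n) for almost all graphs.
module Submission where

open import Data.Bool using (Bool; true; false; not; _∧_; _∨_; if_then_else_)
import Data.Bool.Properties as Bool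
open import Data.Empty using (⊥)
open import Data.Fin using (Fin; zero; suc; toℕ; inject₁; fromℕ; splitAt)
import Data.Fin.Properties as Fin
open import Data.Fin.Subset using (Subset; inside; outside; ∣_∣)
import Data.Integer as ℤ
import Data.Integer.Properties as ℤ
open import Data.List
  using (List; []; _∷_; _++_; length; map; concatMap; allFin; filter; mapMaybe; upTo;
      cartesianProductWith)
import Data.List as List
import Data.List.Properties as List
import Data.List.Membership.DecPropositional as DecMembership
open import Data.List.Membership.Propositional using (_∈_; _∉_; find)
open import Data.List.Membership.Propositional.Properties
  using (∈-map⁺; ∈-map⁻; ∈-++⁺ˡ; ∈-++⁺ʳ; ∈-allFin; ∈-filter⁻; ∈-∃++; ∈-lookup; ∈-upTo⁺; ∈-upTo⁻;
         ∈-concatMap⁻; ∈-cartesianProductWith⁺; ∈-cartesianProductWith⁻)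
open import Data.List.Relation.Binary.Disjoint.Propositional using (Disjoint)
open import Data.List.Relation.Unary.All using (All; []; _∷_)
import Data.List.Relation.Unary.All as All
import Data.List.Relation.Unary.All.Properties as All
open import Data.List.Relation.Unary.AllPairs using ([]; _∷_; allPairs?)
open import Data.List.Relation.Unary.Any using (here; there)
open import Data.List.Relation.Unary.Linked using (Linked; []; [-]; _∷_; linked?)
import Data.List.Relation.Unary.Linked as Linked
open import Data.List.Relation.Unary.Unique.Propositional using (Unique)
import Data.List.Relation.Unary.Unique.Propositional.Properties as Unique
open import Data.Maybe using (Maybe; just; nothing; maybe) renaming (map to mapᴹ)
open import Data.Nat
  using (ℕ; zero; suc; _+_; _*_; _^_; _∸_; ∣_-_∣; _≤_; _<_; _≥_; _≤?_; _≤ᵇ_; _≡ᵇ_; z≤n; s≤s;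
      >-nonZero)
open import Data.Nat.Divisibility using (_∣_; divides)
open import Data.Nat.Induction using (<-rec)
open import Data.Nat.ListAction using (sum)
open import Data.Nat.Properties
open import Data.Nat.Tactic.RingSolver using (solve-∀)
open import Data.Product using (∃-syntax; _×_; _,_; proj₁; proj₂; uncurry)
open import Data.Rational as ℚ using (ℚ; mkℚ; 0ℚ; 1ℚ; _/_)
import Data.Rational.Properties as ℚ
open import Data.Rational.Solver using (module +-*-Solver)
import Data.Rational.Unnormalised as ℚᵘ
import Data.Rational.Unnormalised.Properties as ℚᵘ
open import Data.Sum using (_⊎_; inj₁; inj₂; [_,_]′)
open import Data.Unit using (tt)
open import Data.Vec as Vec using (Vec; []; _∷_; lookup; tabulate; updateAt; replicate)
open import Data.Vec.Properties
  using (lookup∘tabulate; tabulate∘lookup; lookup⇒[]=; []=⇒lookup; lookup∘updateAt; lookup∘updateAt′;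
         lookup-replicate; lookup-splitAt)
open import Defs
open import Function using (_∘_; id; Injective; mk⇔)
open import Function.Bundles using (Equivalence)
open import Relation.Binary.PropositionalEquality
  using (_≡_; _≢_; refl; sym; trans; cong; cong₂; subst; module ≡-Reasoning)
import Relation.Binary.Reasoning.Setoid as ≈-Reasoning
open import Relation.Nullary using (¬_; Dec; yes; no; does; ¬?; contradiction)
open import Relation.Nullary.Decidable
  using (toWitness; dec-true; dec-false; does-⇔; dec⇒maybe; map′; _×-dec_)
open import Relation.Unary using (Decidable)

-- The delicate point is independence. Whether a neighbour `w` of `e` enters depends on whether `e`
-- is covered, hence on the other neighbours of `e`. The branch at `w` is therefore run with `e`
-- declared uncovered. As long as nothing covers `e` this declaration is true, so the branches still
-- decide correctly whether `e` is left over. Domination thus holds for every labelling, and short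
-- cycles enter only through the expectation, where a vertex close to one is charged its trivial
-- cost 2. Each round is allowed two further steps of the graph, so two branches of three rounds
-- that meet form a walk on at most 15 vertices; this is the origin of the constant 15. For random
-- graphs, the switching is composed of flips of matrix entries, which permute all Boolean matrices.
-- For a fixed cycle and edge it is thus a change of variables in a sum over matrices. Since the
-- probability over an empty list is 0, 5-regular graphs of every large even order have to be
-- exhibited as well.

private variable
  A B : Set
  n : ℕ

-- Finite sums

∑ : List A → (A → ℕ) → ℕ
∑ xs f = sum (map f xs)

∑-cong : ∀ (xs : List A) {f g} → (∀ x → f x ≡ g x) → ∑ xs f ≡ ∑ xs g
∑-cong []       f≡g = refl
∑-cong (x ∷ xs) f≡g = cong₂ _+_ (f≡g x) (∑-cong xs f≡g)

∑-mono-∈ : ∀ (xs : List A) {f g} → (∀ {x} → x ∈ xs → f x ≤ g x) → ∑ xs f ≤ ∑ xs g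
∑-mono-∈ []       f≤g = z≤n
∑-mono-∈ (x ∷ xs) f≤g = +-mono-≤ (f≤g (here refl)) (∑-mono-∈ xs (f≤g ∘ there))

∑-mono : ∀ (xs : List A) {f g} → (∀ x → f x ≤ g x) → ∑ xs f ≤ ∑ xs g
∑-mono xs f≤g = ∑-mono-∈ xs (λ _ → f≤g _)

∑-const : ∀ (xs : List A) c → ∑ xs (λ _ → c) ≡ length xs * c
∑-const []       c = refl
∑-const (x ∷ xs) c = cong (c +_) (∑-const xs c)

∑-zero : ∀ (xs : List A) {f} → (∀ {x} → x ∈ xs → f x ≡ 0) → ∑ xs f ≡ 0
∑-zero []       f≡0 = refl
∑-zero (x ∷ xs) f≡0 = cong₂ _+_ (f≡0 (here refl)) (∑-zero xs (f≡0 ∘ there))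

∑-+ : ∀ (xs : List A) f g → ∑ xs (λ x → f x + g x) ≡ ∑ xs f + ∑ xs g
∑-+ []       f g = refl
∑-+ (x ∷ xs) f g = trans (cong (f x + g x +_) (∑-+ xs f g))
  (interchange (f x) (g x) (∑ xs f) (∑ xs g))
  where
  interchange : ∀ a b c d → a + b + (c + d) ≡ a + c + (b + d)
  interchange = solve-∀

∑-*ˡ : ∀ (xs : List A) c f → ∑ xs (λ x → c * f x) ≡ c * ∑ xs f
∑-*ˡ []       c f = sym (*-zeroʳ c)
∑-*ˡ (x ∷ xs) c f = trans (cong (c * f x +_) (∑-*ˡ xs c f)) (sym (*-distribˡ-+ c _ _))

∑-*ʳ : ∀ (xs : List A) c f → ∑ xs (λ x → f x * c) ≡ ∑ xs f * c
∑-*ʳ xs c f = trans (∑-cong xs (λ x → *-comm (f x) c)) (trans (∑-*ˡ xs c f) (*-comm c _))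

∑-swap : ∀ (xs : List A) (ys : List B) (f : A → B → ℕ) →
         ∑ xs (λ x → ∑ ys (f x)) ≡ ∑ ys (λ y → ∑ xs (λ x → f x y))
∑-swap []       ys f = sym (trans (∑-const ys 0) (*-zeroʳ (length ys)))
∑-swap (x ∷ xs) ys f = trans (cong (∑ ys (f x) +_) (∑-swap xs ys f)) (sym (∑-+ ys _ _))

∑-++ : ∀ (xs ys : List A) f → ∑ (xs ++ ys) f ≡ ∑ xs f + ∑ ys f
∑-++ []       ys f = refl
∑-++ (x ∷ xs) ys f = trans (cong (f x +_) (∑-++ xs ys f)) (sym (+-assoc (f x) _ _))

∑-map : ∀ (h : A → B) (xs : List A) f → ∑ (map h xs) f ≡ ∑ xs (f ∘ h)
∑-map h []       f = refl
∑-map h (x ∷ xs) f = cong (f (h x) +_) (∑-map h xs f)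

∑-cartesianProductWith : ∀ {C : Set} (h : A → B → C) xs ys f →
  ∑ (cartesianProductWith h xs ys) f ≡ ∑ xs (λ x → ∑ ys (λ y → f (h x y)))
∑-cartesianProductWith h []       ys f = refl
∑-cartesianProductWith h (x ∷ xs) ys f =
  trans (∑-++ (map (h x) ys) _ f)
        (cong₂ _+_ (∑-map (h x) ys f) (∑-cartesianProductWith h xs ys f))

∑-∈ : ∀ {xs : List A} {x} f → x ∈ xs → f x ≤ ∑ xs f
∑-∈ f (here refl) = m≤m+n _ _
∑-∈ f (there x∈)  = ≤-trans (∑-∈ f x∈) (m≤n+m _ _)

𝟙 : Bool → ℕ
𝟙 b = if b then 1 else 0

𝟙-mono : ∀ {a b} → (a ≡ true → b ≡ true) → 𝟙 a ≤ 𝟙 b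
𝟙-mono {false}         a⇒b = z≤n
𝟙-mono {true}  {true}  a⇒b = ≤-refl
𝟙-mono {true}  {false} a⇒b with () ← a⇒b refl

𝟙-∧ : ∀ a b → 𝟙 (a ∧ b) ≡ 𝟙 a * 𝟙 b
𝟙-∧ false b = refl
𝟙-∧ true  b = sym (+-identityʳ (𝟙 b))

𝟙-not : ∀ a → 𝟙 a + 𝟙 (not a) ≡ 1
𝟙-not false = refl
𝟙-not true  = refl

Unique-++⁻ : ∀ (xs : List A) {ys} → Unique (xs ++ ys) → Unique xs × Unique ys × Disjoint xs ys
Unique-++⁻ []       u       = [] , u , λ ()
Unique-++⁻ (x ∷ xs) (x∉ ∷ u) =
  let (uxs , uys , disj) = Unique-++⁻ xs u in
  (All.++⁻ˡ xs x∉ ∷ uxs) , uys , λ where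
    (here refl , v∈ys) → All.lookup (All.++⁻ʳ xs x∉) v∈ys refl
    (there v∈xs , v∈ys) → disj (v∈xs , v∈ys)

-- Expectation over independent random labels

ι : ℕ → ℚ
ι n = ℤ.+ n / 1

Label : Set
Label = Fin 3

-- Indexed by all round numbers, with value 0 beyond the labels, so that `𝔼₁-label` holds for every
-- round without a bound.
labelProb : ℕ → ℚ
labelProb 0 = ℤ.+ 1 / 6
labelProb 1 = ℤ.+ 2 / 6
labelProb 2 = ℤ.+ 3 / 6
labelProb _ = 0ℚ

𝔼₁ : (Label → ℚ) → ℚ
𝔼₁ g = labelProb 0 ℚ.* g zero ℚ.+ labelProb 1 ℚ.* g (suc zero) ℚ.+ labelProb 2 ℚ.* g (suc (suc zero))

𝔼₁-cong : ∀ {g h} → (∀ l → g l ≡ h l) → 𝔼₁ g ≡ 𝔼₁ h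
𝔼₁-cong g≡h = cong₂ ℚ._+_
  (cong₂ ℚ._+_ (cong (labelProb 0 ℚ.*_) (g≡h _)) (cong (labelProb 1 ℚ.*_) (g≡h _)))
      (cong (labelProb 2 ℚ.*_) (g≡h _))

𝔼₁-mono : ∀ {g h} → (∀ l → g l ℚ.≤ h l) → 𝔼₁ g ℚ.≤ 𝔼₁ h
𝔼₁-mono g≤h = ℚ.+-mono-≤
  (ℚ.+-mono-≤ (ℚ.*-monoˡ-≤-nonNeg (labelProb 0) (g≤h _)) (ℚ.*-monoˡ-≤-nonNeg (labelProb 1) (g≤h _)))
  (ℚ.*-monoˡ-≤-nonNeg (labelProb 2) (g≤h _))

𝔼₁-+ : ∀ g h → 𝔼₁ (λ l → g l ℚ.+ h l) ≡ 𝔼₁ g ℚ.+ 𝔼₁ h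
𝔼₁-+ g h = solve 9 (λ p a a′ q b b′ r c c′ →
    p :* (a :+ a′) :+ q :* (b :+ b′) :+ r :* (c :+ c′)
    := (p :* a :+ q :* b :+ r :* c) :+ (p :* a′ :+ q :* b′ :+ r :* c′)) refl
  (labelProb 0) (g _) (h _) (labelProb 1) (g _) (h _) (labelProb 2) (g _) (h _)
  where open +-*-Solver

𝔼₁-*ʳ : ∀ g c → 𝔼₁ (λ l → g l ℚ.* c) ≡ 𝔼₁ g ℚ.* c
𝔼₁-*ʳ g d = solve 7 (λ p a q b r c d →
    p :* (a :* d) :+ q :* (b :* d) :+ r :* (c :* d) := (p :* a :+ q :* b :+ r :* c) :* d) refl
  (labelProb 0) (g _) (labelProb 1) (g _) (labelProb 2) (g _) d
  where open +-*-Solver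

𝔼₁-const : ∀ c → 𝔼₁ (λ _ → c) ≡ c
𝔼₁-const c = trans
  (solve 4 (λ p q r c → p :* c :+ q :* c :+ r :* c := (p :+ q :+ r) :* c) refl (labelProb 0)
      (labelProb 1) (labelProb 2) c)
  (ℚ.*-identityˡ c)
  where open +-*-Solver

𝔼₁-label : ∀ i → 𝔼₁ (λ l → ι (𝟙 (toℕ l ≡ᵇ i))) ≡ labelProb i
𝔼₁-label 0 = refl
𝔼₁-label 1 = refl
𝔼₁-label 2 = refl
𝔼₁-label (suc (suc (suc i))) = refl

Labelling : ℕ → Set
Labelling = Vec Label

-- The product measure is encoded by averaging one coordinate at a time, which turns the facts below
-- into inductions on the number of vertices. Integrands are natural numbers because only
-- indicators, counts and their products are averaged.
𝔼 : ∀ {n} → (Labelling n → ℕ) → ℚ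
𝔼 {zero}  f = ι (f [])
𝔼 {suc n} f = 𝔼₁ (λ l → 𝔼 (λ ω → f (l ∷ ω)))

toℚᵘ-ι : ∀ n → ℚ.toℚᵘ (ι n) ℚᵘ.≃ ℚᵘ.mkℚᵘ (ℤ.+ n) 0
toℚᵘ-ι n = ℚ.toℚᵘ-fromℚᵘ (ℚᵘ.mkℚᵘ (ℤ.+ n) 0)

ι-+ : ∀ a b → ι (a + b) ≡ ι a ℚ.+ ι b
ι-+ a b = ℚ.toℚᵘ-injective (begin
  ℚ.toℚᵘ (ι (a + b))                                ≈⟨ toℚᵘ-ι (a + b) ⟩
  ℚᵘ.mkℚᵘ (ℤ.+ (a + b)) 0
      ≈⟨ ℚᵘ.*≡* (cong (ℤ._* ℤ.1ℤ) (trans (ℤ.pos-+ a b)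
           (sym (cong₂ ℤ._+_ (ℤ.*-identityʳ (ℤ.+ a)) (ℤ.*-identityʳ (ℤ.+ b)))))) ⟩
  ℚᵘ.mkℚᵘ (ℤ.+ a) 0 ℚᵘ.+ ℚᵘ.mkℚᵘ (ℤ.+ b) 0          ≈⟨ ℚᵘ.+-cong (toℚᵘ-ι a) (toℚᵘ-ι b) ⟨
  ℚ.toℚᵘ (ι a) ℚᵘ.+ ℚ.toℚᵘ (ι b)                    ≈⟨ ℚ.toℚᵘ-homo-+ (ι a) (ι b) ⟨
  ℚ.toℚᵘ (ι a ℚ.+ ι b)                              ∎)
  where open ≈-Reasoning ℚᵘ.≃-setoid

ι-* : ∀ a b → ι (a * b) ≡ ι a ℚ.* ι b
ι-* a b = ℚ.toℚᵘ-injective (begin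
  ℚ.toℚᵘ (ι (a * b))                                ≈⟨ toℚᵘ-ι (a * b) ⟩
  ℚᵘ.mkℚᵘ (ℤ.+ (a * b)) 0                           ≈⟨ ℚᵘ.*≡* (cong (ℤ._* ℤ.1ℤ) (ℤ.pos-* a b)) ⟩
  ℚᵘ.mkℚᵘ (ℤ.+ a) 0 ℚᵘ.* ℚᵘ.mkℚᵘ (ℤ.+ b) 0          ≈⟨ ℚᵘ.*-cong (toℚᵘ-ι a) (toℚᵘ-ι b) ⟨
  ℚ.toℚᵘ (ι a) ℚᵘ.* ℚ.toℚᵘ (ι b)                    ≈⟨ ℚ.toℚᵘ-homo-* (ι a) (ι b) ⟨
  ℚ.toℚᵘ (ι a ℚ.* ι b)                              ∎)
  where open ≈-Reasoning ℚᵘ.≃-setoid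

ι-mono : ∀ {a b} → a ≤ b → ι a ℚ.≤ ι b
ι-mono {a} {b} a≤b = ℚ.toℚᵘ-cancel-≤ (begin
  ℚ.toℚᵘ (ι a)       ≃⟨ toℚᵘ-ι a ⟩
  ℚᵘ.mkℚᵘ (ℤ.+ a) 0  ≤⟨ ℚᵘ.*≤* (ℤ.*-monoʳ-≤-nonNeg ℤ.1ℤ (ℤ.+≤+ a≤b)) ⟩
  ℚᵘ.mkℚᵘ (ℤ.+ b) 0  ≃⟨ toℚᵘ-ι b ⟨
  ℚ.toℚᵘ (ι b)       ∎)
  where open ℚᵘ.≤-Reasoning

ι-cancel-≤ : ∀ {a b} → ι a ℚ.≤ ι b → a ≤ b
ι-cancel-≤ {a} {b} ιa≤ιb = ℤ.drop‿+≤+ (ℤ.*-cancelʳ-≤-pos (ℤ.+ a) (ℤ.+ b) ℤ.1ℤ (ℚᵘ.drop-*≤* (begin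
  ℚᵘ.mkℚᵘ (ℤ.+ a) 0  ≃⟨ toℚᵘ-ι a ⟨
  ℚ.toℚᵘ (ι a)       ≤⟨ ℚ.toℚᵘ-mono-≤ ιa≤ιb ⟩
  ℚ.toℚᵘ (ι b)       ≃⟨ toℚᵘ-ι b ⟩
  ℚᵘ.mkℚᵘ (ℤ.+ b) 0  ∎)))
  where open ℚᵘ.≤-Reasoning

𝔼-cong : {f g : Labelling n → ℕ} → (∀ ω → f ω ≡ g ω) → 𝔼 f ≡ 𝔼 g
𝔼-cong {zero}  f≡g = cong ι (f≡g [])
𝔼-cong {suc n} f≡g = 𝔼₁-cong (λ l → 𝔼-cong (λ ω → f≡g (l ∷ ω)))

𝔼-mono : {f g : Labelling n → ℕ} → (∀ ω → f ω ≤ g ω) → 𝔼 f ℚ.≤ 𝔼 g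
𝔼-mono {zero}  f≤g = ι-mono (f≤g [])
𝔼-mono {suc n} f≤g = 𝔼₁-mono (λ l → 𝔼-mono (λ ω → f≤g (l ∷ ω)))

𝔼-const : ∀ n c → 𝔼 {n} (λ _ → c) ≡ ι c
𝔼-const zero    c = refl
𝔼-const (suc n) c = trans (𝔼₁-cong (λ _ → 𝔼-const n c)) (𝔼₁-const (ι c))

𝔼-+ : (f g : Labelling n → ℕ) → 𝔼 (λ ω → f ω + g ω) ≡ 𝔼 f ℚ.+ 𝔼 g
𝔼-+ {zero}  f g = ι-+ (f []) (g [])
𝔼-+ {suc n} f g = trans (𝔼₁-cong (λ l → 𝔼-+ (f ∘ (l ∷_)) (g ∘ (l ∷_))))
  (𝔼₁-+ (λ l → 𝔼 (f ∘ (l ∷_))) (λ l → 𝔼 (g ∘ (l ∷_))))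

𝔼-lookup : ∀ (v : Fin n) (f : Label → ℕ) → 𝔼 (λ ω → f (lookup ω v)) ≡ 𝔼₁ (ι ∘ f)
𝔼-lookup {suc n} zero    f = 𝔼₁-cong (λ l → 𝔼-const n (f l))
𝔼-lookup {suc n} (suc v) f = trans (𝔼₁-cong (λ _ → 𝔼-lookup v f)) (𝔼₁-const _)

-- Linearity with an error term: `a` is the value of an undisturbed vertex, and `b x` pays for the
-- short cycles near `x`.
𝔼-∑-≤ : ∀ (xs : List A) (f : A → Labelling n → ℕ) a b →
        (∀ x → 𝔼 (f x) ℚ.≤ a ℚ.+ ι (b x)) →
        𝔼 (λ ω → ∑ xs (λ x → f x ω)) ℚ.≤ ι (length xs) ℚ.* a ℚ.+ ι (∑ xs b)
𝔼-∑-≤ {n = n} []       f a b f≤ = ℚ.≤-reflexive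
    (trans (𝔼-const n 0) (sym (cong (ℚ._+ 0ℚ) (ℚ.*-zeroˡ a))))
𝔼-∑-≤ (x ∷ xs) f a b f≤ = begin
  𝔼 (λ ω → f x ω + ∑ xs (λ x → f x ω))                              ≡⟨ 𝔼-+ (f x) _ ⟩
  𝔼 (f x) ℚ.+ 𝔼 (λ ω → ∑ xs (λ x → f x ω))
      ≤⟨ ℚ.+-mono-≤ (f≤ x) (𝔼-∑-≤ xs f a b f≤) ⟩
  (a ℚ.+ ι (b x)) ℚ.+ (ι (length xs) ℚ.* a ℚ.+ ι (∑ xs b))
    ≡⟨ solve 4 (λ a b l c → (a :+ b) :+ (l :* a :+ c) := (con 1ℚ :+ l) :* a :+ (b :+ c)) refl a
        (ι (b x)) (ι (length xs)) (ι (∑ xs b)) ⟩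
  (1ℚ ℚ.+ ι (length xs)) ℚ.* a ℚ.+ (ι (b x) ℚ.+ ι (∑ xs b))
    ≡⟨ cong₂ (λ l c → l ℚ.* a ℚ.+ c) (ι-+ 1 (length xs)) (ι-+ (b x) (∑ xs b)) ⟨
  ι (suc (length xs)) ℚ.* a ℚ.+ ι (b x + ∑ xs b)                    ∎
  where
  open ℚ.≤-Reasoning
  open +-*-Solver

DependsOn : (Labelling n → A) → (Fin n → Set) → Set
DependsOn f D = ∀ ω ω′ → (∀ {i} → D i → lookup ω i ≡ lookup ω′ i) → f ω ≡ f ω′

private
  DependsOn-∷ : ∀ {f : Labelling (suc n) → A} {D} l → DependsOn f D → DependsOn (f ∘ (l ∷_)) (D ∘ suc)
  DependsOn-∷ {n = n} {D = D} l f-dep ω ω′ ω≡ω′ = f-dep (l ∷ ω) (l ∷ ω′) agree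
    where
    agree : ∀ {i} → D i → lookup (l ∷ ω) i ≡ lookup (l ∷ ω′) i
    agree {zero}  d = refl
    agree {suc i} d = ω≡ω′ d

  DependsOn-head : ∀ {f : Labelling (suc n) → A} {D} → ¬ D zero → DependsOn f D →
                   ∀ l l′ ω → f (l ∷ ω) ≡ f (l′ ∷ ω)
  DependsOn-head {D = D} ¬D₀ f-dep l l′ ω = f-dep (l ∷ ω) (l′ ∷ ω) agree
    where
    agree : ∀ {i} → D i → lookup (l ∷ ω) i ≡ lookup (l′ ∷ ω) i
    agree {zero}  d = contradiction d ¬D₀
    agree {suc i} d = refl

-- At each coordinate at most one factor sees the head label. The other is constant in it and can be
-- taken out of the average; deciding `D` tells which one.
𝔼-indep : ∀ {f g : Labelling n → ℕ} {D D′} → Decidable D → DependsOn f D → DependsOn g D′ →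
          (∀ {i} → D i → ¬ D′ i) → 𝔼 (λ ω → f ω * g ω) ≡ 𝔼 f ℚ.* 𝔼 g
𝔼-indep {zero}  {f} {g} D? f-dep g-dep disj = ι-* (f []) (g [])
𝔼-indep {suc n} {f} {g} D? f-dep g-dep disj = trans
  (𝔼₁-cong λ l → 𝔼-indep (D? ∘ suc) (DependsOn-∷ l f-dep) (DependsOn-∷ l g-dep) disj)
  (split (D? zero))
  where
  F G : Label → ℚ
  F l = 𝔼 (λ ω → f (l ∷ ω))
  G l = 𝔼 (λ ω → g (l ∷ ω))
  onlyF : (∀ l → G l ≡ G zero) → 𝔼₁ (λ l → F l ℚ.* G l) ≡ 𝔼₁ F ℚ.* 𝔼₁ G
  onlyF G-const = begin
    𝔼₁ (λ l → F l ℚ.* G l)      ≡⟨ 𝔼₁-cong (λ l → cong (F l ℚ.*_) (G-const l)) ⟩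
    𝔼₁ (λ l → F l ℚ.* G zero)   ≡⟨ 𝔼₁-*ʳ F (G zero) ⟩
    𝔼₁ F ℚ.* G zero             ≡⟨ cong (𝔼₁ F ℚ.*_) (𝔼₁-const (G zero)) ⟨
    𝔼₁ F ℚ.* 𝔼₁ (λ _ → G zero)  ≡⟨ cong (𝔼₁ F ℚ.*_) (𝔼₁-cong G-const) ⟨
    𝔼₁ F ℚ.* 𝔼₁ G               ∎
    where open ≡-Reasoning
  onlyG : (∀ l → F l ≡ F zero) → 𝔼₁ (λ l → F l ℚ.* G l) ≡ 𝔼₁ F ℚ.* 𝔼₁ G
  onlyG F-const = begin
    𝔼₁ (λ l → F l ℚ.* G l)
        ≡⟨ 𝔼₁-cong (λ l → trans (cong (ℚ._* G l) (F-const l)) (ℚ.*-comm (F zero) (G l))) ⟩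
    𝔼₁ (λ l → G l ℚ.* F zero)   ≡⟨ 𝔼₁-*ʳ G (F zero) ⟩
    𝔼₁ G ℚ.* F zero             ≡⟨ ℚ.*-comm (𝔼₁ G) (F zero) ⟩
    F zero ℚ.* 𝔼₁ G             ≡⟨ cong (ℚ._* 𝔼₁ G) (𝔼₁-const (F zero)) ⟨
    𝔼₁ (λ _ → F zero) ℚ.* 𝔼₁ G  ≡⟨ cong (ℚ._* 𝔼₁ G) (𝔼₁-cong F-const) ⟨
    𝔼₁ F ℚ.* 𝔼₁ G               ∎
    where open ≡-Reasoning
  split : Dec _ → 𝔼₁ (λ l → F l ℚ.* G l) ≡ 𝔼₁ F ℚ.* 𝔼₁ G
  split (yes d) = onlyF λ l → 𝔼-cong (DependsOn-head (disj d) g-dep l zero)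
  split (no ¬d) = onlyG λ l → 𝔼-cong (DependsOn-head ¬d f-dep l zero)

𝔼-not : (X : Labelling n → Bool) → 𝔼 (𝟙 ∘ not ∘ X) ≡ 1ℚ ℚ.- 𝔼 (𝟙 ∘ X)
𝔼-not {n} X = begin
  𝔼 (𝟙 ∘ not ∘ X)                                   ≡⟨ solve 2 (λ a b → b := (a :+ b) :- a) refl
      (𝔼 (𝟙 ∘ X)) (𝔼 (𝟙 ∘ not ∘ X)) ⟩
  (𝔼 (𝟙 ∘ X) ℚ.+ 𝔼 (𝟙 ∘ not ∘ X)) ℚ.- 𝔼 (𝟙 ∘ X)
      ≡⟨ cong (ℚ._- 𝔼 (𝟙 ∘ X)) (𝔼-+ (𝟙 ∘ X) (𝟙 ∘ not ∘ X)) ⟨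
  𝔼 (λ ω → 𝟙 (X ω) + 𝟙 (not (X ω))) ℚ.- 𝔼 (𝟙 ∘ X)
      ≡⟨ cong (ℚ._- 𝔼 (𝟙 ∘ X)) (trans (𝔼-cong (𝟙-not ∘ X)) (𝔼-const n 1)) ⟩
  1ℚ ℚ.- 𝔼 (𝟙 ∘ X)                                  ∎
  where
  open ≡-Reasoning
  open +-*-Solver

-- The probability that h holds for a sum of m independent indicators of mean s.
binomial : ℕ → ℚ → (ℕ → Bool) → ℚ
binomial zero    s h = ι (𝟙 (h 0))
binomial (suc m) s h = s ℚ.* binomial m s (h ∘ suc) ℚ.+ (1ℚ ℚ.- s) ℚ.* binomial m s h

count : (A → Bool) → List A → ℕ
count X xs = ∑ xs (𝟙 ∘ X)

module _ (X : A → Labelling n → Bool) (D : A → List (Fin n)) where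
  open import Data.List.Membership.DecPropositional (Fin._≟_ {n}) using (_∈?_)

  count-dependsOn : ∀ xs → (∀ {x} → x ∈ xs → DependsOn (X x) (_∈ D x)) →
                    DependsOn (λ ω → count (λ x → X x ω) xs) (_∈ concatMap D xs)
  count-dependsOn []       X-dep ω ω′ ω≡ω′ = refl
  count-dependsOn (x ∷ xs) X-dep ω ω′ ω≡ω′ = cong₂ _+_
    (cong 𝟙 (X-dep (here refl) ω ω′ (ω≡ω′ ∘ ∈-++⁺ˡ)))
    (count-dependsOn xs (X-dep ∘ there) ω ω′ (ω≡ω′ ∘ ∈-++⁺ʳ (D x)))

  -- Conditioning on the first indicator reproduces the recursion of `binomial`. Uniqueness of the
  -- concatenated supports encodes that they are pairwise disjoint, which makes the indicators
  -- independent.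
  𝔼-count : ∀ {s} xs → (∀ {x} → x ∈ xs → DependsOn (X x) (_∈ D x)) →
            (∀ {x} → x ∈ xs → 𝔼 (𝟙 ∘ X x) ≡ s) → Unique (concatMap D xs) →
            ∀ h → 𝔼 (λ ω → 𝟙 (h (count (λ x → X x ω) xs))) ≡ binomial (length xs) s h
  𝔼-count {s} []       X-dep 𝔼X u h = 𝔼-const n _
  𝔼-count {s} (x ∷ xs) X-dep 𝔼X u h = begin
    𝔼 (λ ω → 𝟙 (h (𝟙 (X x ω) + N ω)))
      ≡⟨ 𝔼-cong (λ ω → by-cases (X x ω) (N ω)) ⟩
    𝔼 (λ ω → 𝟙 (X x ω) * 𝟙 (h (suc (N ω))) + 𝟙 (not (X x ω)) * 𝟙 (h (N ω)))
      ≡⟨ 𝔼-+ (λ ω → 𝟙 (X x ω) * 𝟙 (h (suc (N ω)))) _ ⟩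
    𝔼 (λ ω → 𝟙 (X x ω) * 𝟙 (h (suc (N ω)))) ℚ.+ 𝔼 (λ ω → 𝟙 (not (X x ω)) * 𝟙 (h (N ω)))
      ≡⟨ cong₂ ℚ._+_
           (𝔼-indep (_∈? D x) (λ ω ω′ → cong 𝟙 ∘ X-dep (here refl) ω ω′)
                    (λ ω ω′ → cong (𝟙 ∘ h ∘ suc) ∘ N-dep ω ω′) disj)
           (𝔼-indep (_∈? D x) (λ ω ω′ → cong (𝟙 ∘ not) ∘ X-dep (here refl) ω ω′)
                    (λ ω ω′ → cong (𝟙 ∘ h) ∘ N-dep ω ω′) disj) ⟩
    𝔼 (𝟙 ∘ X x) ℚ.* 𝔼 (λ ω → 𝟙 (h (suc (N ω)))) ℚ.+ 𝔼 (𝟙 ∘ not ∘ X x) ℚ.* 𝔼 (λ ω → 𝟙 (h (N ω)))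
      ≡⟨ cong₂ ℚ._+_
           (cong₂ ℚ._*_ (𝔼X (here refl)) (rec (h ∘ suc)))
           (cong₂ ℚ._*_ (trans (𝔼-not (X x)) (cong (λ s → 1ℚ ℚ.- s) (𝔼X (here refl)))) (rec h)) ⟩
    binomial (suc (length xs)) s h ∎
    where
    open ≡-Reasoning
    N : Labelling n → ℕ
    N ω = count (λ x → X x ω) xs
    N-dep : DependsOn N (_∈ concatMap D xs)
    N-dep = count-dependsOn xs (X-dep ∘ there)
    split = Unique-++⁻ (D x) u
    disj : ∀ {i} → i ∈ D x → i ∉ concatMap D xs
    disj i∈ i∈′ = proj₂ (proj₂ split) (i∈ , i∈′)
    rec : ∀ h → 𝔼 (λ ω → 𝟙 (h (N ω))) ≡ binomial (length xs) s h
    rec = 𝔼-count xs (X-dep ∘ there) (𝔼X ∘ there) (proj₁ (proj₂ split))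
    by-cases : ∀ b m → 𝟙 (h (𝟙 b + m)) ≡ 𝟙 b * 𝟙 (h (suc m)) + 𝟙 (not b) * 𝟙 (h m)
    by-cases true  m = sym (trans (+-identityʳ _) (+-identityʳ _))
    by-cases false m = sym (+-identityʳ _)

Unique-concatMap⁻ : ∀ (D : A → List B) {x xs} → x ∈ xs → Unique (concatMap D xs) → Unique (D x)
Unique-concatMap⁻ D {xs = y ∷ _} (here refl) u = proj₁ (Unique-++⁻ (D y) u)
Unique-concatMap⁻ D {xs = y ∷ _} (there x∈)  u =
  Unique-concatMap⁻ D x∈ (proj₁ (proj₂ (Unique-++⁻ (D y) u)))

-- Neighbourhoods as duplicate-free lists.

infixl 6 _∖_

_∖_ : List (Fin n) → Fin n → List (Fin n)
xs ∖ e = filter (λ x → ¬? (x Fin.≟ e)) xs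

∑-∖ : ∀ {xs : List (Fin n)} {e} → Unique xs → e ∈ xs → ∀ f → ∑ xs f ≡ f e + ∑ (xs ∖ e) f
∑-∖ {xs = x ∷ xs} {e} (e∉xs ∷ u) (here refl) f = cong (λ ys → f x + ∑ ys f) (sym (trans
  (List.filter-reject (λ x → ¬? (x Fin.≟ e)) (λ e≢e → e≢e refl))
  (List.filter-all (λ x → ¬? (x Fin.≟ e)) (All.map (λ e≢x x≡e → e≢x (sym x≡e)) e∉xs))))
∑-∖ {xs = x ∷ xs} {e} (x∉xs ∷ u) (there e∈xs) f = begin
  f x + ∑ xs f                ≡⟨ cong (f x +_) (∑-∖ u e∈xs f) ⟩
  f x + (f e + ∑ (xs ∖ e) f)  ≡⟨ +-assoc (f x) (f e) _ ⟨
  f x + f e + ∑ (xs ∖ e) f    ≡⟨ cong (_+ ∑ (xs ∖ e) f) (+-comm (f x) (f e)) ⟩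
  f e + f x + ∑ (xs ∖ e) f    ≡⟨ +-assoc (f e) (f x) _ ⟩
  f e + ∑ (x ∷ xs ∖ e) f    ≡⟨ cong (λ ys → f e + ∑ ys f) (List.filter-accept (λ x → ¬? (x Fin.≟ e))
      (All.lookup x∉xs e∈xs)) ⟨
  f e + ∑ ((x ∷ xs) ∖ e) f    ∎
  where open ≡-Reasoning

length-∖ : ∀ {xs : List (Fin n)} {e} → Unique xs → e ∈ xs → length xs ≡ suc (length (xs ∖ e))
length-∖ {xs = xs} {e} u e∈xs = begin
  length xs                 ≡⟨ *-identityʳ _ ⟨
  length xs * 1             ≡⟨ ∑-const xs 1 ⟨
  ∑ xs (λ _ → 1)            ≡⟨ ∑-∖ u e∈xs (λ _ → 1) ⟩
  suc (∑ (xs ∖ e) (λ _ → 1)) ≡⟨ cong suc (trans (∑-const (xs ∖ e) 1) (*-identityʳ _)) ⟩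
  suc (length (xs ∖ e))     ∎
  where open ≡-Reasoning

count-zero : ∀ {X : A → Bool} {xs} → (∀ {x} → x ∈ xs → X x ≡ false) → count X xs ≡ 0
count-zero {xs = xs} none = ∑-zero xs (cong 𝟙 ∘ none)

∑-𝟙-≟ : ∀ (x : Fin n) → count (λ y → does (x Fin.≟ y)) (allFin n) ≡ 1
∑-𝟙-≟ {n} x = trans (∑-∖ (Unique.allFin⁺ n) (∈-allFin x) _)
  (cong₂ _+_ (cong 𝟙 (dec-true (x Fin.≟ x) refl))
      (count-zero λ {y} y∈ → ≢⇒ y (proj₂ (∈-filter⁻ (λ y → ¬? (y Fin.≟ x)) {xs = allFin n} y∈))))
  where
  ≢⇒ : ∀ y → y ≢ x → does (x Fin.≟ y) ≡ false
  ≢⇒ y y≢x with x Fin.≟ y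
  ... | yes x≡y = contradiction (sym x≡y) y≢x
  ... | no  _   = refl

elements : Subset n → List (Fin n)
elements []            = []
elements (inside  ∷ S) = zero ∷ map suc (elements S)
elements (outside ∷ S) = map suc (elements S)

length-elements : ∀ (S : Subset n) → length (elements S) ≡ ∣ S ∣
length-elements []            = refl
length-elements (inside  ∷ S) = cong suc (trans (List.length-map suc (elements S))
    (length-elements S))
length-elements (outside ∷ S) = trans (List.length-map suc (elements S)) (length-elements S)

∈-elements⁺ : ∀ (S : Subset n) {x} → lookup S x ≡ inside → x ∈ elements S
∈-elements⁺ (inside  ∷ S) {zero}  x∈ = here refl
∈-elements⁺ (inside  ∷ S) {suc x} x∈ = there (∈-map⁺ suc (∈-elements⁺ S x∈))
∈-elements⁺ (outside ∷ S) {suc x} x∈ = ∈-map⁺ suc (∈-elements⁺ S x∈)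

∈-elements⁻ : ∀ (S : Subset n) {x} → x ∈ elements S → lookup S x ≡ inside
∈-elements⁻ (inside  ∷ S) (here refl) = refl
∈-elements⁻ (inside  ∷ S) (there x∈) with _ , y∈ , refl ← ∈-map⁻ suc x∈ = ∈-elements⁻ S y∈
∈-elements⁻ (outside ∷ S) x∈         with _ , y∈ , refl ← ∈-map⁻ suc x∈ = ∈-elements⁻ S y∈

elements-unique : ∀ (S : Subset n) → Unique (elements S)
elements-unique []            = []
elements-unique (inside  ∷ S) =
  All.map⁺ (All.universal (λ _ ()) (elements S)) ∷ Unique.map⁺ Fin.suc-injective (elements-unique S)
elements-unique (outside ∷ S) = Unique.map⁺ Fin.suc-injective (elements-unique S)

∣tabulate∣ : ∀ {n} (g : Fin n → A) (X : A → Bool) → ∣ tabulate (X ∘ g) ∣ ≡ count X (List.tabulate g)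
∣tabulate∣ {n = zero}  g X = refl
∣tabulate∣ {n = suc n} g X with X (g zero)
... | true  = cong suc (∣tabulate∣ (g ∘ suc) X)
... | false = ∣tabulate∣ (g ∘ suc) X

count-positive : ∀ (X : A → Bool) {x xs} → x ∈ xs → X x ≡ true → not (count X xs ≡ᵇ 0) ≡ true
count-positive X {xs = xs} x∈ Xx with count X xs | ≤-trans (≤-reflexive (sym (cong 𝟙 Xx)))
    (∑-∈ (𝟙 ∘ X) x∈)
... | suc _ | _ = refl

𝟙-positive : ∀ m → 𝟙 (not (m ≡ᵇ 0)) ≤ m
𝟙-positive zero    = z≤n
𝟙-positive (suc m) = s≤s z≤n

𝟙-∨ : ∀ a b → 𝟙 (a ∨ b) ≤ 𝟙 a + 𝟙 b
𝟙-∨ false b = ≤-refl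
𝟙-∨ true  b = m≤m+n 1 (𝟙 b)

search : ∀ (X : A → Bool) xs → (∃[ x ] x ∈ xs × X x ≡ true) ⊎ (∀ {x} → x ∈ xs → X x ≡ false)
search X [] = inj₂ λ ()
search X (x ∷ xs) with X x in eq | search X xs
... | true  | _                    = inj₁ (x , here refl , eq)
... | false | inj₁ (y , y∈ , Xy)   = inj₁ (y , there y∈ , Xy)
... | false | inj₂ none            = inj₂ λ where
  (here refl) → eq
  (there x∈)  → none x∈

-- The round-based greedy process

-- In round 0 all five neighbours are uncovered, so the vertices labelled 0
-- enter unconditionally.  Together with labelProb, these thresholds give an
-- expected cost of about 0.3598 per vertex.
threshold : ℕ → ℕ
threshold 2 = 3
threshold _ = 4

-- The process on the infinite 5-regular tree: `m` counts the branches of a vertex and `j` the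
-- neighbours declared uncovered. Thus `0 5` describes a root and `1 4` a vertex seen from its
-- parent. In `freeProb` the 4 counts the neighbours other than the one asking.
joinProb : ℕ → ℕ → ℕ → ℚ
freeProb : ℕ → ℚ
joinProb zero    j m = 0ℚ
joinProb (suc i) j m =
  joinProb i j m ℚ.+ labelProb i ℚ.* binomial m (freeProb i) (λ c → threshold i ≤ᵇ j + c)
freeProb i = binomial 4 (joinProb i 1 4) (_≡ᵇ 0)

-- The root enters, or none of its five neighbours does when the root is regarded as uncovered and
-- one neighbour has to be added for it.
expectedCost : ℚ
expectedCost = joinProb 3 0 5 ℚ.+ binomial 5 (joinProb 3 1 4) (_≡ᵇ 0)

expectedCost≤9/25 : expectedCost ℚ.≤ (ℤ.+ 9 / 25)
expectedCost≤9/25 = toWitness {a? = expectedCost ℚ.≤? (ℤ.+ 9 / 25)} tt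

module Process {n} (G : Graph n) (reg : Regular 5 G) where

  N : Fin n → List (Fin n)
  N v = elements (neighbours G v)

  N-unique : ∀ v → Unique (N v)
  N-unique v = elements-unique (neighbours G v)

  ∈N⇒adjacent : ∀ {u v} → u ∈ N v → Adjacent G v u
  ∈N⇒adjacent {u} {v} u∈ = lookup⇒[]= u (neighbours G v) (∈-elements⁻ (neighbours G v) u∈)

  adjacent⇒∈N : ∀ {u v} → Adjacent G v u → u ∈ N v
  adjacent⇒∈N {u} {v} v~u = ∈-elements⁺ (neighbours G v) ([]=⇒lookup v~u)

  N-sym : ∀ {u v} → u ∈ N v → v ∈ N u
  N-sym {u} {v} u∈ = adjacent⇒∈N (symmetric G v u (∈N⇒adjacent u∈))

  N-irrefl : ∀ {v} → v ∉ N v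
  N-irrefl {v} v∈ = loopless G v (∈N⇒adjacent v∈)

  N-length : ∀ v → length (N v) ≡ 5
  N-length v = trans (length-elements (neighbours G v)) (reg v)

  N∖-length : ∀ {u v} → u ∈ N v → length (N v ∖ u) ≡ 4
  N∖-length {u} {v} u∈ = suc-injective (trans (sym (length-∖ (N-unique v) u∈)) (N-length v))

  N∖-⊆ : ∀ {u v x} → x ∈ N v ∖ u → x ∈ N v
  N∖-⊆ {u} {v} x∈ = proj₁ (∈-filter⁻ (λ x → ¬? (x Fin.≟ u)) {xs = N v} x∈)

  N∖-≢ : ∀ {u v x} → x ∈ N v ∖ u → x ≢ u
  N∖-≢ {u} {v} x∈ = proj₂ (∈-filter⁻ (λ x → ¬? (x Fin.≟ u)) {xs = N v} x∈)

  -- joined i j fs v: v enters before round i, if its uncovered neighbours are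
  -- taken to be the free ones among fs and j more.  The part of the process
  -- that e sees through its neighbour v has j = 1 and fs = N v ∖ e, so that
  -- it does not depend on what happens beyond e.
  joined : ℕ → ℕ → List (Fin n) → Fin n → Labelling n → Bool
  free   : ℕ → Fin n → Fin n → Labelling n → Bool
  joined zero    j fs v ω = false
  joined (suc i) j fs v ω = joined i j fs v ω ∨
    (toℕ (lookup ω v) ≡ᵇ i) ∧ (threshold i ≤ᵇ j + count (λ f → free i v f ω) fs)
  -- `v` is left out here: the answer matters only in the round of the label of `v`, before which
  -- `v` has not entered.
  free i v f ω = count (λ w → joined i 1 (N w ∖ f) w ω) (N f ∖ v) ≡ᵇ 0

  -- Vertices whose labels suffice, listed along the branches of the process. A vertex reached along
  -- two routes occurs twice, so `Unique` for this list expresses that the explored part is a tree.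
  -- One list with parameter `m` serves all rounds up to `m`.
  joinSupport : ℕ → List (Fin n) → Fin n → List (Fin n)
  freeSupport : ℕ → Fin n → Fin n → List (Fin n)
  joinSupport zero    fs v = []
  joinSupport (suc m) fs v = v ∷ concatMap (freeSupport m v) fs
  freeSupport m v f = concatMap (λ w → joinSupport m (N w ∖ f) w) (N f ∖ v)

  joined-dependsOn : ∀ {i m} → i ≤ m → ∀ j fs v → DependsOn (joined i j fs v) (_∈ joinSupport m fs v)
  free-dependsOn   : ∀ {i m} → i ≤ m → ∀ v f → DependsOn (free i v f) (_∈ freeSupport m v f)
  joined-dependsOn {zero}          z≤n       j fs v ω ω′ ω≡ω′ = refl
  joined-dependsOn {suc i} {suc m} (s≤s i≤m) j fs v ω ω′ ω≡ω′ = cong₂ _∨_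
    (joined-dependsOn (m≤n⇒m≤1+n i≤m) j fs v ω ω′ ω≡ω′)
    (cong₂ _∧_
      (cong (λ l → toℕ l ≡ᵇ i) (ω≡ω′ (here refl)))
      (cong (λ c → threshold i ≤ᵇ j + c)
        (count-dependsOn (free i v) (freeSupport m v) fs (λ _ → free-dependsOn i≤m v _) ω ω′
            (ω≡ω′ ∘ there))))
  free-dependsOn {i} {m} i≤m v f ω ω′ ω≡ω′ = cong (_≡ᵇ 0)
    (count-dependsOn (λ w → joined i 1 (N w ∖ f) w) (λ w → joinSupport m (N w ∖ f) w) (N f ∖ v)
      (λ {w} _ → joined-dependsOn i≤m 1 (N w ∖ f) w) ω ω′ ω≡ω′)

  -- A vertex can only enter in the round of its own label. Hence entering in different rounds are
  -- exclusive events, and their probabilities add up.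
  joined-label : ∀ i j fs v ω → joined i j fs v ω ≡ true → toℕ (lookup ω v) < i
  joined-label (suc i) j fs v ω J with joined i j fs v ω in eq
  ... | true  = m≤n⇒m≤1+n (joined-label i j fs v ω eq)
  ... | false with toℕ (lookup ω v) ≡ᵇ i in eq′
  ...   | true = s≤s (≤-reflexive (≡ᵇ⇒≡ _ _ (Equivalence.from Bool.T-≡ eq′)))

  -- Uniqueness of the support is used twice: its head makes the label of `v` independent of all
  -- branches, and its tail makes the branches independent of each other.
  𝔼-joined : ∀ {i m} → i ≤ m → ∀ j fs v → (∀ {f} → f ∈ fs → f ∈ N v) →
             Unique (joinSupport m fs v) → 𝔼 (𝟙 ∘ joined i j fs v) ≡ joinProb i j (length fs)
  𝔼-free : ∀ {i m} → i ≤ m → ∀ {v f} → f ∈ N v →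
           Unique (freeSupport m v f) → 𝔼 (𝟙 ∘ free i v f) ≡ freeProb i
  𝔼-joined {zero} z≤n j fs v fs⊆ u = 𝔼-const n 0
  𝔼-joined {suc i} {suc m} (s≤s i≤m) j fs v fs⊆ u@(v∉ ∷ u′) = begin
    𝔼 (λ ω → 𝟙 (joined i j fs v ω ∨ label ω ∧ enough ω))
      ≡⟨ 𝔼-cong (λ ω → disjoint (joined i j fs v ω) (label ω) (enough ω) (exclusive ω)) ⟩
    𝔼 (λ ω → 𝟙 (joined i j fs v ω) + 𝟙 (label ω) * 𝟙 (enough ω))
      ≡⟨ 𝔼-+ (𝟙 ∘ joined i j fs v) _ ⟩
    𝔼 (𝟙 ∘ joined i j fs v) ℚ.+ 𝔼 (λ ω → 𝟙 (label ω) * 𝟙 (enough ω))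
      ≡⟨ cong₂ ℚ._+_ (𝔼-joined (m≤n⇒m≤1+n i≤m) j fs v fs⊆ u)
           (𝔼-indep {D = _≡ v} (Fin._≟ v)
             (λ ω ω′ ω≡ω′ → cong (λ l → 𝟙 (toℕ l ≡ᵇ i)) (ω≡ω′ refl))
             (λ ω ω′ ω≡ω′ → cong (λ c → 𝟙 (threshold i ≤ᵇ j + c)) (free-count-dep ω ω′ ω≡ω′))
             λ {refl x∈ → All.lookup v∉ x∈ refl}) ⟩
    joinProb i j (length fs) ℚ.+ 𝔼 (𝟙 ∘ label) ℚ.* 𝔼 (𝟙 ∘ enough)
      ≡⟨ cong₂ (λ a b → joinProb i j (length fs) ℚ.+ a ℚ.* b)
           (trans (𝔼-lookup v (λ l → 𝟙 (toℕ l ≡ᵇ i))) (𝔼₁-label i))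
           (𝔼-count (free i v) (freeSupport m v) fs (λ _ → free-dependsOn i≤m v _)
             (λ f∈ → 𝔼-free i≤m (fs⊆ f∈) (Unique-concatMap⁻ (freeSupport m v) f∈ u′)) u′
             (λ c → threshold i ≤ᵇ j + c)) ⟩
    joinProb (suc i) j (length fs) ∎
    where
    open ≡-Reasoning
    label enough : Labelling n → Bool
    label ω = toℕ (lookup ω v) ≡ᵇ i
    enough ω = threshold i ≤ᵇ j + count (λ f → free i v f ω) fs
    free-count-dep : DependsOn (λ ω → count (λ f → free i v f ω) fs)
        (_∈ concatMap (freeSupport m v) fs)
    free-count-dep = count-dependsOn (free i v) (freeSupport m v) fs (λ _ → free-dependsOn i≤m v _)
    exclusive : ∀ ω → joined i j fs v ω ≡ true → label ω ≡ false
    exclusive ω J with label ω in eq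
    ... | false = refl
    ... | true  = contradiction (≡ᵇ⇒≡ _ _ (Equivalence.from Bool.T-≡ eq))
        (<⇒≢ (joined-label i j fs v ω J))
    disjoint : ∀ a b c → (a ≡ true → b ≡ false) → 𝟙 (a ∨ b ∧ c) ≡ 𝟙 a + 𝟙 b * 𝟙 c
    disjoint false b     c a⇒¬b = 𝟙-∧ b c
    disjoint true  false c a⇒¬b = refl
    disjoint true  true  c a⇒¬b with () ← a⇒¬b refl
  𝔼-free {i} {m} i≤m {v} {f} f∈ u = trans
    (𝔼-count (λ w → joined i 1 (N w ∖ f) w) (λ w → joinSupport m (N w ∖ f) w) (N f ∖ v)
      (λ {w} _ → joined-dependsOn i≤m 1 (N w ∖ f) w)
      (λ {w} w∈ → trans
        (𝔼-joined i≤m 1 (N w ∖ f) w N∖-⊆ (Unique-concatMap⁻ (λ w → joinSupport m (N w ∖ f) w) w∈ u))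
        (cong (joinProb i 1) (N∖-length (N-sym (N∖-⊆ w∈)))))
      u (_≡ᵇ 0))
    (cong (λ l → binomial l (joinProb i 1 4) (_≡ᵇ 0)) (N∖-length (N-sym f∈)))

  -- If no neighbour of e enters then e is uncovered throughout, and regarding
  -- it as uncovered makes no difference.
  joined-uncovered : ∀ i {e} ω → (∀ {w} → w ∈ N e → joined i 0 (N w) w ω ≡ false) →
                     ∀ {w} → w ∈ N e → joined i 1 (N w ∖ e) w ω ≡ false
  joined-uncovered zero        ω none w∈ = refl
  joined-uncovered (suc i) {e} ω none {w} w∈ = cong₂ _∨_ (earlier w∈)
      (trans (cong (λ c → (toℕ (lookup ω w) ≡ᵇ i) ∧ (threshold i ≤ᵇ c)) same-count)
                                    (Bool.∨-conicalʳ (joined i 0 (N w) w ω) _ (none w∈)))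
    where
    earlier : ∀ {w} → w ∈ N e → joined i 1 (N w ∖ e) w ω ≡ false
    earlier = joined-uncovered i ω (λ {w} w∈ → Bool.∨-conicalˡ (joined i 0 (N w) w ω) _ (none w∈))
    e-free : free i w e ω ≡ true
    e-free = cong (_≡ᵇ 0) (count-zero {xs = N e ∖ w} (earlier ∘ N∖-⊆))
    same-count : 1 + count (λ f → free i w f ω) (N w ∖ e) ≡ count (λ f → free i w f ω) (N w)
    same-count = sym (trans (∑-∖ (N-unique w) (N-sym w∈) _)
      (cong (λ b → 𝟙 b + count (λ f → free i w f ω) (N w ∖ e)) e-free))

  -- `missed` uses the branch view, in which `e` is regarded as uncovered, because there the five
  -- neighbours can be independent. By `joined-uncovered` it still catches every vertex without a
  -- chosen neighbour.
  chosen missed : Fin n → Labelling n → Bool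
  chosen v = joined 3 0 (N v) v
  missed e ω = count (λ w → joined 3 1 (N w ∖ e) w ω) (N e) ≡ᵇ 0

  cost : Fin n → Labelling n → ℕ
  cost v ω = 𝟙 (chosen v ω) + 𝟙 (missed v ω)

  someNeighbour : ∀ v → ∃[ u ] u ∈ N v
  someNeighbour v with N v | N-length v
  ... | u ∷ _ | _ = u , here refl

  repairsAt : Fin n → Labelling n → Fin n → Bool
  repairsAt u ω e = missed e ω ∧ does (proj₁ (someNeighbour e) Fin.≟ u)

  selected : Labelling n → Fin n → Bool
  selected ω u = chosen u ω ∨ not (count (repairsAt u ω) (allFin n) ≡ᵇ 0)

  -- Domination is certain for each labelling: either some neighbour is chosen, or `e` counts as
  -- missed and its designated neighbour is added.
  selected-dominates : ∀ ω → TotalDominating G (tabulate (selected ω))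
  selected-dominates ω e with search (λ w → chosen w ω) (N e)
  ... | inj₁ (w , w∈ , w-chosen) =
    w , lookup⇒[]= w _ (trans (lookup∘tabulate (selected ω) w)
        (cong (_∨ not (count (repairsAt w ω) (allFin n) ≡ᵇ 0)) w-chosen))
      , ∈N⇒adjacent w∈
  ... | inj₂ none =
    u , lookup⇒[]= u _ (trans (lookup∘tabulate (selected ω) u)
          (trans (cong (chosen u ω ∨_) (count-positive (repairsAt u ω) (∈-allFin e)
                   (cong₂ _∧_ e-missed (dec-true (u Fin.≟ u) refl))))
                 (Bool.∨-zeroʳ (chosen u ω))))
      , ∈N⇒adjacent (proj₂ (someNeighbour e))
    where
    u = proj₁ (someNeighbour e)
    e-missed : missed e ω ≡ true
    e-missed = cong (_≡ᵇ 0) (count-zero {xs = N e} (joined-uncovered 3 ω none))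

  -- Added vertices are charged to the missed vertices that ask for them: after exchanging the sums,
  -- each missed vertex pays for a single designated neighbour.
  γₜ-≤-cost : ∀ ω → γₜ G ≤ ∑ (allFin n) (λ v → cost v ω)
  γₜ-≤-cost ω = begin
    γₜ G
      ≤⟨ γₜ-minimal G (tabulate (selected ω)) (selected-dominates ω) ⟩
    ∣ tabulate (selected ω) ∣
      ≡⟨ ∣tabulate∣ id (selected ω) ⟩
    count (selected ω) V
      ≤⟨ ∑-mono V (λ u → ≤-trans (𝟙-∨ (chosen u ω) _)
           (+-monoʳ-≤ (𝟙 (chosen u ω)) (𝟙-positive (count (repairsAt u ω) V)))) ⟩
    ∑ V (λ u → 𝟙 (chosen u ω) + count (repairsAt u ω) V)
      ≡⟨ ∑-+ V _ _ ⟩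
    count (λ u → chosen u ω) V + ∑ V (λ u → count (repairsAt u ω) V)
      ≡⟨ cong (count (λ u → chosen u ω) V +_) (∑-swap V V (λ u e → 𝟙 (repairsAt u ω e))) ⟩
    count (λ u → chosen u ω) V + ∑ V (λ e → ∑ V (λ u → 𝟙 (repairsAt u ω e)))
      ≡⟨ cong (count (λ u → chosen u ω) V +_) (∑-cong V one-repair) ⟩
    count (λ u → chosen u ω) V + count (λ e → missed e ω) V
      ≡⟨ ∑-+ V _ _ ⟨
    ∑ V (λ v → cost v ω) ∎
    where
    open ≤-Reasoning
    V = allFin n
    one-repair : ∀ e → ∑ V (λ u → 𝟙 (repairsAt u ω e)) ≡ 𝟙 (missed e ω)
    one-repair e = trans (∑-cong V (λ u → 𝟙-∧ (missed e ω) _))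
      (trans (∑-*ˡ V (𝟙 (missed e ω)) _)
        (trans (cong (𝟙 (missed e ω) *_) (∑-𝟙-≟ (proj₁ (someNeighbour e)))) (*-identityʳ _)))

  missSupport : Fin n → List (Fin n)
  missSupport v = concatMap (λ w → joinSupport 3 (N w ∖ v) w) (N v)

  𝔼-cost : ∀ v → Unique (joinSupport 3 (N v) v) → Unique (missSupport v) →
           𝔼 (cost v) ≡ expectedCost
  𝔼-cost v u₁ u₂ = trans (𝔼-+ (𝟙 ∘ chosen v) (𝟙 ∘ missed v)) (cong₂ ℚ._+_
    (trans (𝔼-joined ≤-refl 0 (N v) v id u₁) (cong (joinProb 3 0) (N-length v)))
    (trans
      (𝔼-count (λ w → joined 3 1 (N w ∖ v) w) (λ w → joinSupport 3 (N w ∖ v) w) (N v)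
        (λ {w} _ → joined-dependsOn ≤-refl 1 (N w ∖ v) w)
        (λ {w} w∈ → trans
          (𝔼-joined ≤-refl 1 (N w ∖ v) w N∖-⊆ (Unique-concatMap⁻ (λ w → joinSupport 3 (N w ∖ v) w)
              w∈ u₂))
          (cong (joinProb 3 1) (N∖-length (N-sym w∈))))
        u₂ (_≡ᵇ 0))
      (cong (λ l → binomial l (joinProb 3 1 4) (_≡ᵇ 0)) (N-length v))))

Unique-concatMap⁺ : ∀ (D : A → List B) {xs} → Unique xs → (∀ {x} → x ∈ xs → Unique (D x)) →
  (∀ {x y} → x ∈ xs → y ∈ xs → x ≢ y → Disjoint (D x) (D y)) → Unique (concatMap D xs)
Unique-concatMap⁺ D {[]}     u          uD disj = []
Unique-concatMap⁺ D {x ∷ xs} (x∉ ∷ u) uD disj = Unique.++⁺ (uD (here refl))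
  (Unique-concatMap⁺ D u (uD ∘ there) (λ y∈ z∈ → disj (there y∈) (there z∈)))
  λ (v∈x , v∈xs) → let y , y∈ , v∈y = find (∈-concatMap⁻ D v∈xs) in
    disj (here refl) (there y∈) (All.lookup x∉ y∈) (v∈x , v∈y)

-- Short cycles

Adj : AdjMatrix n → Fin n → Fin n → Set
Adj M x y = lookup (lookup M x) y ≡ true

endpoint : A → List A → A
endpoint x []       = x
endpoint x (y ∷ ys) = endpoint y ys

-- A list encoding of `Cycle` that can be decided and enumerated on bare matrices. The length of the
-- cycle is `suc (length xs)`. A cycle appears once for each root and direction, which affects only
-- constants.
record IsCycle (M : AdjMatrix n) (x : Fin n) (xs : List (Fin n)) : Set where
  constructor mkIsCycle
  field
    long     : 2 ≤ length xs
    distinct : Unique (x ∷ xs)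
    path     : Linked (Adj M) (x ∷ xs)
    closes   : Adj M (endpoint x xs) x

isCycle? : ∀ (M : AdjMatrix n) x xs → Dec (IsCycle M x xs)
isCycle? M x xs = map′ (λ (a , b , c , d) → mkIsCycle a b c d) (λ (mkIsCycle a b c d) → a , b , c , d)
  ((2 ≤? length xs) ×-dec allPairs? (λ x y → ¬? (x Fin.≟ y)) (x ∷ xs)
    ×-dec linked? (λ x y → lookup (lookup M x) y Bool.≟ true) (x ∷ xs)
    ×-dec (lookup (lookup M (endpoint x xs)) x Bool.≟ true))

tuples : ∀ n → ℕ → List (List (Fin n))
tuples n zero    = [] ∷ []
tuples n (suc k) = cartesianProductWith _∷_ (allFin n) (tuples n k)

∈-tuples : ∀ (xs : List (Fin n)) → xs ∈ tuples n (length xs)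
∈-tuples []       = here refl
∈-tuples (x ∷ xs) = ∈-cartesianProductWith⁺ _∷_ (∈-allFin x) (∈-tuples xs)

∑-candidates : ∀ n → ℕ → (Fin n → List (Fin n) → ℕ) → ℕ
∑-candidates n K f = ∑ (upTo (suc K)) λ k → ∑ (allFin n) λ x → ∑ (tuples n k) (f x)

∑-candidates-∈ : ∀ {K} f (x : Fin n) xs → length xs ≤ K → f x xs ≤ ∑-candidates n K f
∑-candidates-∈ {n} {K} f x xs l≤ = ≤-trans (∑-∈ (f x) (∈-tuples xs))
  (≤-trans (∑-∈ (λ x → ∑ (tuples n (length xs)) (f x)) (∈-allFin x))
           (∑-∈ (λ k → ∑ (allFin n) λ x → ∑ (tuples n k) (f x)) (∈-upTo⁺ (s≤s l≤))))

∑-candidates-*ʳ : ∀ K c (f : Fin n → List (Fin n) → ℕ) →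
  ∑-candidates n K (λ x xs → f x xs * c) ≡ ∑-candidates n K f * c
∑-candidates-*ʳ {n} K c f = begin
  ∑ ks (λ k → ∑ V λ x → ∑ (tuples n k) λ xs → f x xs * c)
    ≡⟨ ∑-cong ks (λ k → ∑-cong V (λ x → ∑-*ʳ (tuples n k) c (f x))) ⟩
  ∑ ks (λ k → ∑ V λ x → ∑ (tuples n k) (f x) * c)
    ≡⟨ ∑-cong ks (λ k → ∑-*ʳ V c (λ x → ∑ (tuples n k) (f x))) ⟩
  ∑ ks (λ k → (∑ V λ x → ∑ (tuples n k) (f x)) * c)
    ≡⟨ ∑-*ʳ ks c (λ k → ∑ V λ x → ∑ (tuples n k) (f x)) ⟩
  ∑-candidates n K f * c ∎
  where
  open ≡-Reasoning
  ks = upTo (suc K)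
  V = allFin n

shortCycles : ∀ {n} → ℕ → AdjMatrix n → ℕ
shortCycles {n} K M = ∑-candidates n K λ x xs → 𝟙 (does (isCycle? M x xs))

module _ {R : A → A → Set} where
  Linked-prefix : ∀ {x z} ys {zs} → Linked R (x ∷ ys ++ z ∷ zs) →
                  Linked R (x ∷ ys) × R (endpoint x ys) z
  Linked-prefix []       (Rxz ∷ _) = [-] , Rxz
  Linked-prefix (y ∷ ys) (Rxy ∷ l) = let l′ , r = Linked-prefix ys l in Rxy ∷ l′ , r

-- Non-backtracking walks and the tree structure around a vertex.

module Unfolding {n} (G : Graph n) (reg : Regular 5 G) where
  open Process G reg
  open import Data.List.Membership.DecPropositional (Fin._≟_ {n}) using (_∈?_)

  data NonBacktracking : List (Fin n) → Set where
    [-]  : ∀ {x} → NonBacktracking (x ∷ [])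
    edge : ∀ {x y} → y ∈ N x → NonBacktracking (x ∷ y ∷ [])
    turn : ∀ {x y z zs} → y ∈ N x → x ≢ z → NonBacktracking (y ∷ z ∷ zs) →
           NonBacktracking (x ∷ y ∷ z ∷ zs)

  NonBacktracking⇒Linked : ∀ {xs} → NonBacktracking xs → Linked (Adj (matrix G)) xs
  NonBacktracking⇒Linked [-]            = [-]
  NonBacktracking⇒Linked (edge y∈)      = ∈-elements⁻ (neighbours G _) y∈ ∷ [-]
  NonBacktracking⇒Linked (turn y∈ _ nb) = ∈-elements⁻ (neighbours G _) y∈ ∷ NonBacktracking⇒Linked nb

  NonBacktracking-tail : ∀ {x y ys} → NonBacktracking (x ∷ y ∷ ys) → NonBacktracking (y ∷ ys)
  NonBacktracking-tail (edge _)      = [-]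
  NonBacktracking-tail (turn _ _ nb) = nb

  -- A return after one step would be a loop and a return after two steps would backtrack, so at
  -- least two vertices lie in between.
  first-return : ∀ {x} ys {zs} → NonBacktracking (x ∷ ys ++ x ∷ zs) → Unique (ys ++ x ∷ zs) →
                 IsCycle (matrix G) x ys
  first-return []           (edge x∈)      u = contradiction x∈ N-irrefl
  first-return []           (turn x∈ _ _)  u = contradiction x∈ N-irrefl
  first-return (y ∷ [])     (turn _ x≢x _) u = contradiction refl x≢x
  first-return {x} ys@(_ ∷ _ ∷ _) nb u =
    let u′ , _ , disj = Unique-++⁻ ys u
        l , closes    = Linked-prefix ys (NonBacktracking⇒Linked nb) in
    mkIsCycle (s≤s (s≤s z≤n))
      (All.tabulate (λ y∈ x≡y → disj (subst (_∈ ys) (sym x≡y) y∈ , here refl)) ∷ u′) l closes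

  -- The walk is read from its end: the first vertex that repeats one of the distinct vertices after
  -- it closes a cycle.
  contains-cycle : ∀ {xs} → NonBacktracking xs →
    Unique xs ⊎ ∃[ x ] ∃[ ys ] (IsCycle (matrix G) x ys × x ∈ xs × length ys ≤ length xs)
  contains-cycle {x ∷ []}     nb = inj₁ ([] ∷ [])
  contains-cycle {x ∷ y ∷ ys} nb with contains-cycle (NonBacktracking-tail nb)
  ... | inj₂ (z , zs , c , z∈ , l≤) = inj₂ (z , zs , c , there z∈ , m≤n⇒m≤1+n l≤)
  ... | inj₁ u with x ∈? (y ∷ ys)
  ...   | no  x∉ = inj₁ (All.¬Any⇒All¬ _ x∉ ∷ u)
  ...   | yes x∈ with as , bs , eq ← ∈-∃++ x∈ = inj₂
    (x , as , first-return as (subst (NonBacktracking ∘ (x ∷_)) eq nb) (subst Unique eq u) ,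
     here refl , l≤)
    where
    l≤ : length as ≤ suc (length (y ∷ ys))
    l≤ = m≤n⇒m≤1+n (subst (length as ≤_) (sym (trans (cong length eq) (List.length-++ as)))
        (m≤m+n (length as) _))

  data Near : ℕ → Fin n → Fin n → Set where
    here : ∀ {r v} → Near r v v
    _▸_  : ∀ {r v x y} → Near r v x → y ∈ N x → Near (suc r) v y

  Near-mono : ∀ {r s v x} → r ≤ s → Near r v x → Near s v x
  Near-mono r≤s       here      = here
  Near-mono (s≤s r≤s) (nr ▸ y∈) = Near-mono r≤s nr ▸ y∈

  Near-∷ : ∀ {r v f x} → f ∈ N v → Near r f x → Near (suc r) v x
  Near-∷ f∈ here      = here ▸ f∈
  Near-∷ f∈ (nr ▸ y∈) = Near-∷ f∈ nr ▸ y∈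

  NoCycleNear : ℕ → Fin n → Set
  NoCycleNear K v = ∀ {x xs} → IsCycle (matrix G) x xs → length xs ≤ K → ¬ Near K v x

  NoCycleNear-mono : ∀ {K L v} → K ≤ L → NoCycleNear L v → NoCycleNear K v
  NoCycleNear-mono K≤L nc c l≤ nr = nc c (≤-trans l≤ K≤L) (Near-mono K≤L nr)

  NoCycleNear-step : ∀ {K v f} → f ∈ N v → NoCycleNear (suc K) v → NoCycleNear K f
  NoCycleNear-step f∈ nc c l≤ nr = nc c (m≤n⇒m≤1+n l≤) (Near-∷ f∈ nr)

  -- A non-backtracking walk of length k from v to z whose first step does not
  -- lead to e.
  data Walk : ℕ → Fin n → Fin n → Fin n → Set where
    stop : ∀ {e v} → Walk 0 e v v
    step : ∀ {k e v f z} → f ∈ N v → f ≢ e → Walk k v f z → Walk (suc k) e v z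

  no-return : ∀ {K v x xs} → NoCycleNear K v → NonBacktracking (x ∷ xs) → x ∈ xs →
              All (Near K v) (x ∷ xs) → length (x ∷ xs) ≤ K → ⊥
  no-return nc nb x∈ nears l≤ with contains-cycle nb
  ... | inj₁ (x∉ ∷ _) = All.lookup x∉ x∈ refl
  ... | inj₂ (y , ys , c , y∈ , l≤′) = nc c (≤-trans l≤′ l≤) (All.lookup nears y∈)

  forward : ∀ {r u v k f z} → Near r u v → f ∈ N v → Walk k v f z →
    ∃[ xs ] (NonBacktracking (v ∷ f ∷ xs) × z ∈ f ∷ xs × length xs ≡ k ×
             All (Near (suc k + r) u) (v ∷ f ∷ xs))
  forward nv f∈ stop = [] , edge f∈ , here refl , refl , Near-mono (m≤n+m _ 1) nv ∷ (nv ▸ f∈) ∷ []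
  forward {r} {u} {k = suc k} {f} nv f∈ (step {f = g} g∈ g≢v w) =
    let xs , nb , z∈ , l , nears = forward (nv ▸ f∈) g∈ w in
    g ∷ xs , turn f∈ (g≢v ∘ sym) nb , there z∈ , cong suc l ,
    Near-mono (m≤n+m r (2 + k)) nv ∷ subst (λ s → All (Near s u) (f ∷ g ∷ xs)) (+-suc (suc k) r) nears

  -- Putting each new vertex in front reverses the walk. The condition that its first step avoids
  -- `e` is what keeps the junction from backtracking.
  backward : ∀ {r u v k e z xs} →
    NonBacktracking (v ∷ e ∷ xs) → All (Near r u) (v ∷ e ∷ xs) → Walk k e v z →
    ∃[ ys ] (NonBacktracking (z ∷ ys) × (∀ {x} → x ∈ e ∷ xs → x ∈ ys) ×
             length ys ≡ k + suc (length xs) × All (Near (k + r) u) (z ∷ ys))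
  backward nb nears stop = _ , nb , id , refl , nears
  backward {r} {u} {k = suc k} {z = z} nb nears@(nv ∷ _) (step f∈ f≢e w) =
    let ys , nb′ , ⊆ys , l , nears′ = backward (turn (N-sym f∈) f≢e nb)
            ((nv ▸ f∈) ∷ All.map (Near-mono (n≤1+n r)) nears) w in
    ys , nb′ , ⊆ys ∘ there , trans l (+-suc k _) , subst (λ s → All (Near s u) (z ∷ ys)) (+-suc k r)
        nears′

  no-closed-walk : ∀ {K v k f} → NoCycleNear K v → 2 + k ≤ K → f ∈ N v → ¬ Walk k v f v
  no-closed-walk {k = k} nc k≤ f∈ w =
    let ys , nb , ⊆ys , l , nears = backward (edge (N-sym f∈)) ((here ▸ f∈) ∷ here ∷ []) w in
    no-return nc nb (⊆ys (here refl))
        (All.map (Near-mono (≤-trans (≤-trans (≤-reflexive (+-comm k 1)) (n≤1+n _)) k≤)) nears)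
      (≤-trans (≤-reflexive (cong suc (trans l (+-comm k 1)))) k≤)

  -- One walk is followed outwards by `forward` and the other glued to it in reverse by `backward`;
  -- `f ≢ f′` prevents backtracking at `v`. The result visits `z` twice and has `3 + (k + k′)`
  -- vertices, hence the bound.
  no-diamond : ∀ {K v k k′ f f′ z} → NoCycleNear K v → 3 + (k + k′) ≤ K →
               f ∈ N v → f′ ∈ N v → f ≢ f′ →
               Walk k v f z → ¬ Walk k′ v f′ z
  no-diamond {k = k} {k′} nc k≤ f∈ f′∈ f≢f′ w w′ =
    let xs , nb , z∈ , l , nears = forward here f∈ w
        ys , nb′ , ⊆ys , l′ , nears′ =
          backward (turn (N-sym f′∈) (f≢f′ ∘ sym) nb) (Near-mono (s≤s z≤n) (here ▸ f′∈) ∷ nears) w′ in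
    no-return nc nb′ (⊆ys (there z∈))
      (All.map (Near-mono (≤-trans (≤-reflexive (lem₁ k k′)) (≤-trans (m≤n+m _ 2) k≤))) nears′)
      (≤-trans (≤-reflexive (trans (cong suc (trans l′ (cong (λ l → k′ + suc (suc l)) l)))
          (lem₂ k k′))) k≤)
    where
    lem₁ : ∀ k k′ → k′ + (suc k + 0) ≡ suc (k + k′)
    lem₁ = solve-∀
    lem₂ : ∀ k k′ → suc (k′ + suc (suc k)) ≡ 3 + (k + k′)
    lem₂ = solve-∀

  -- A round looks two steps ahead: to a neighbour `f`, and on to the vertices that may have covered
  -- `f`. This gives the factor 2.
  joinSupport-walk : ∀ m {e v z fs} → (∀ {f} → f ∈ fs → f ∈ N v × f ≢ e) → z ∈ joinSupport m fs v →
                     ∃[ k ] (k ≤ m * 2 × Walk k e v z)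
  freeSupport-walk : ∀ m {v f z} → z ∈ freeSupport m v f → ∃[ k ] (k ≤ 1 + m * 2 × Walk k v f z)
  joinSupport-walk (suc m) fs⊆ (here refl) = 0 , z≤n , stop
  joinSupport-walk (suc m) fs⊆ (there z∈)  =
    let f , f∈ , z∈f = find (∈-concatMap⁻ (freeSupport m _) z∈)
        k , k≤ , w   = freeSupport-walk m z∈f in
    suc k , s≤s k≤ , step (proj₁ (fs⊆ f∈)) (proj₂ (fs⊆ f∈)) w
  freeSupport-walk m {v} {f} z∈ =
    let w , w∈ , z∈w = find (∈-concatMap⁻ (λ w → joinSupport m (N w ∖ f) w) z∈)
        k , k≤ , wk  = joinSupport-walk m (λ f∈ → N∖-⊆ f∈ , N∖-≢ f∈) z∈w in
    suc k , s≤s k≤ , step (N∖-⊆ w∈) (N∖-≢ w∈) wk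

  -- A repetition either returns to the root, a closed walk, or lies in two branches at a common
  -- vertex, a diamond. Two walks of length at most `m * 2` need radius `3 + m * 4` in
  -- `branches-unique`; one more step on both sides gives `1 + suc m * 4` here. Three rounds seen
  -- from a missed vertex thus need `3 + 3 * 4`, that is 15.
  joinSupport-unique : ∀ m {v fs} → NoCycleNear (1 + m * 4) v → Unique fs →
      (∀ {f} → f ∈ fs → f ∈ N v) →
                       Unique (joinSupport m fs v)
  branches-unique : ∀ m {f ws} → NoCycleNear (3 + m * 4) f → Unique ws → (∀ {w} → w ∈ ws → w ∈ N f) →
                    Unique (concatMap (λ w → joinSupport m (N w ∖ f) w) ws)
  joinSupport-unique zero    nc u fs⊆ = []
  joinSupport-unique (suc m) {v} nc u fs⊆ =
    All.tabulate (λ z∈ v≡z →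
      let f , f∈ , z∈f = find (∈-concatMap⁻ (freeSupport m v) z∈)
          k , k≤ , w   = freeSupport-walk m z∈f in
      no-closed-walk nc (≤-trans (+-monoʳ-≤ 2 k≤)
          (+-mono-≤ (≤ᵇ⇒≤ 3 5 tt) (*-monoʳ-≤ m (≤ᵇ⇒≤ 2 4 tt)))) (fs⊆ f∈)
          (subst (Walk k v f) (sym v≡z) w))
    ∷ Unique-concatMap⁺ (freeSupport m v) u
        (λ f∈ → branches-unique m (NoCycleNear-mono (n≤1+n _) (NoCycleNear-step (fs⊆ f∈) nc))
                  (Unique.filter⁺ _ (N-unique _)) N∖-⊆)
        (λ f∈ f′∈ f≢f′ (z∈ , z∈′) →
          let k  , k≤  , w  = freeSupport-walk m z∈
              k′ , k′≤ , w′ = freeSupport-walk m z∈′ in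
          no-diamond nc (≤-trans (+-monoʳ-≤ 3 (+-mono-≤ k≤ k′≤)) (≤-reflexive (lem m)))
            (fs⊆ f∈) (fs⊆ f′∈) f≢f′ w w′)
    where
    lem : ∀ m → 3 + (1 + m * 2 + (1 + m * 2)) ≡ 5 + m * 4
    lem = solve-∀
  branches-unique m {f} nc u ws⊆ = Unique-concatMap⁺ _ u
    (λ w∈ → joinSupport-unique m (NoCycleNear-mono (n≤1+n _) (NoCycleNear-step (ws⊆ w∈) nc))
              (Unique.filter⁺ _ (N-unique _)) N∖-⊆)
    (λ w∈ w′∈ w≢w′ (z∈ , z∈′) →
      let k  , k≤  , wk  = joinSupport-walk m (λ f∈ → N∖-⊆ f∈ , N∖-≢ f∈) z∈
          k′ , k′≤ , wk′ = joinSupport-walk m (λ f∈ → N∖-⊆ f∈ , N∖-≢ f∈) z∈′ in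
      no-diamond nc (≤-trans (+-monoʳ-≤ 3 (+-mono-≤ k≤ k′≤)) (≤-reflexive (lem m)))
        (ws⊆ w∈) (ws⊆ w′∈) w≢w′ wk wk′)
    where
    lem : ∀ m → 3 + (m * 2 + m * 2) ≡ 3 + m * 4
    lem = solve-∀

  -- The number of walks of length at most `r` from `x` to `v`. It dominates the indicator of `Near`
  -- and, unlike a distance, is easily summed over `v`.
  near : ℕ → Fin n → Fin n → ℕ
  near zero    v x = 𝟙 (does (x Fin.≟ v))
  near (suc r) v x = 𝟙 (does (x Fin.≟ v)) + ∑ (N x) (near r v)

  Near⇒near : ∀ {r v x} → Near r v x → 1 ≤ near r v x
  Near⇒near {zero}  {v} here = ≤-reflexive (sym (cong 𝟙 (dec-true (v Fin.≟ v) refl)))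
  Near⇒near {suc r} {v} here = ≤-trans (≤-reflexive (sym (cong 𝟙 (dec-true (v Fin.≟ v) refl))))
      (m≤m+n _ _)
  Near⇒near {suc r} {v} {y} (nr ▸ y∈) =
    ≤-trans (Near⇒near nr) (≤-trans (∑-∈ (near r v) (N-sym y∈)) (m≤n+m _ (𝟙 (does (y Fin.≟ v)))))

  ∑-near : ∀ r x → ∑ (allFin n) (λ v → near r v x) ≤ 6 ^ r
  ∑-near zero    x = ≤-reflexive (∑-𝟙-≟ x)
  ∑-near (suc r) x = begin
    ∑ V (λ v → 𝟙 (does (x Fin.≟ v)) + ∑ (N x) (near r v))  ≡⟨ ∑-+ V _ _ ⟩
    count (λ v → does (x Fin.≟ v)) V + ∑ V (λ v → ∑ (N x) (near r v))
      ≡⟨ cong₂ _+_ (∑-𝟙-≟ x) (∑-swap V (N x) (near r)) ⟩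
    1 + ∑ (N x) (λ y → ∑ V (λ v → near r v y))  ≤⟨ +-monoʳ-≤ 1 (∑-mono (N x) (∑-near r)) ⟩
    1 + ∑ (N x) (λ _ → 6 ^ r)
        ≡⟨ cong (1 +_) (trans (∑-const (N x) _) (cong (_* 6 ^ r) (N-length x))) ⟩
    1 + 5 * 6 ^ r                               ≤⟨ +-monoˡ-≤ (5 * 6 ^ r) (m^n>0 6 r) ⟩
    6 ^ suc r                                   ∎
    where
    open ≤-Reasoning
    V = allFin n

  cyclesNear : ℕ → Fin n → ℕ
  cyclesNear K v = ∑-candidates n K λ x xs → 𝟙 (does (isCycle? (matrix G) x xs)) * near K v x

  cyclesNear≡0 : ∀ K v → cyclesNear K v ≡ 0 → NoCycleNear K v
  cyclesNear≡0 K v none {x} {xs} c l≤ nr = contradiction none (m<n⇒n≢0 (begin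
    1
        ≤⟨ *-mono-≤ (≤-reflexive (sym (cong 𝟙 (dec-true (isCycle? (matrix G) x xs) c))))
        (Near⇒near nr) ⟩
    𝟙 (does (isCycle? (matrix G) x xs)) * near K v x
        ≤⟨ ∑-candidates-∈ (λ x xs → 𝟙 (does (isCycle? (matrix G) x xs)) * near K v x) x xs l≤ ⟩
    cyclesNear K v                                             ∎))
    where open ≤-Reasoning

  ∑-cyclesNear : ∀ K → ∑ (allFin n) (cyclesNear K) ≤ shortCycles K (matrix G) * 6 ^ K
  ∑-cyclesNear K = begin
    ∑ V (λ v → ∑ ks λ k → ∑ V λ x → ∑ (tuples n k) λ xs → 𝟙 (cyc x xs) * near K v x)
      ≡⟨ ∑-swap V ks _ ⟩
    ∑ ks (λ k → ∑ V λ v → ∑ V λ x → ∑ (tuples n k) λ xs → 𝟙 (cyc x xs) * near K v x)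
      ≡⟨ ∑-cong ks (λ k → ∑-swap V V _) ⟩
    ∑ ks (λ k → ∑ V λ x → ∑ V λ v → ∑ (tuples n k) λ xs → 𝟙 (cyc x xs) * near K v x)
      ≡⟨ ∑-cong ks (λ k → ∑-cong V (λ x → ∑-swap V (tuples n k) _)) ⟩
    ∑ ks (λ k → ∑ V λ x → ∑ (tuples n k) λ xs → ∑ V λ v → 𝟙 (cyc x xs) * near K v x)
      ≤⟨ ∑-mono ks (λ k → ∑-mono V (λ x → ∑-mono (tuples n k) (λ xs →
           ≤-trans (≤-reflexive (∑-*ˡ V (𝟙 (cyc x xs)) _))
               (*-monoʳ-≤ (𝟙 (cyc x xs)) (∑-near K x))))) ⟩
    ∑ ks (λ k → ∑ V λ x → ∑ (tuples n k) λ xs → 𝟙 (cyc x xs) * 6 ^ K)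
      ≡⟨ ∑-candidates-*ʳ K (6 ^ K) (λ x xs → 𝟙 (cyc x xs)) ⟩
    shortCycles K (matrix G) * 6 ^ K ∎
    where
    open ≤-Reasoning
    V = allFin n
    ks = upTo (suc K)
    cyc : Fin n → List (Fin n) → Bool
    cyc x xs = does (isCycle? (matrix G) x xs)

  -- Without a short cycle nearby the tree value is exact. Otherwise `cyclesNear K v` is at least 1,
  -- and twice it covers the largest possible cost of a vertex, which is 2.
  𝔼-cost-≤ : ∀ {K} → 15 ≤ K → ∀ v → 𝔼 (cost v) ℚ.≤ (ℤ.+ 9 / 25) ℚ.+ ι (2 * cyclesNear K v)
  𝔼-cost-≤ {K} 15≤K v = by-cases (cyclesNear K v) refl
    where
    open ℚ.≤-Reasoning
    by-cases : ∀ b → cyclesNear K v ≡ b → 𝔼 (cost v) ℚ.≤ (ℤ.+ 9 / 25) ℚ.+ ι (2 * b)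
    by-cases zero none = begin
      𝔼 (cost v)       ≡⟨ 𝔼-cost v
        (joinSupport-unique 3 (NoCycleNear-mono (≤-trans (≤ᵇ⇒≤ 13 15 tt) 15≤K) nc) (N-unique v) id)
        (branches-unique 3 (NoCycleNear-mono 15≤K nc) (N-unique v) id) ⟩
      expectedCost     ≤⟨ expectedCost≤9/25 ⟩
      ℤ.+ 9 / 25       ≡⟨ ℚ.+-identityʳ _ ⟨
      (ℤ.+ 9 / 25) ℚ.+ ι 0 ∎
      where
      nc : NoCycleNear K v
      nc = cyclesNear≡0 K v none
    by-cases (suc b) some = begin
      𝔼 (cost v)
          ≤⟨ 𝔼-mono (λ ω → ≤-trans (+-mono-≤ (𝟙≤1 (chosen v ω)) (𝟙≤1 (missed v ω)))
          (*-monoʳ-≤ 2 (s≤s z≤n))) ⟩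
      𝔼 {n} (λ _ → 2 * suc b)         ≡⟨ 𝔼-const n (2 * suc b) ⟩
      ι (2 * suc b)                   ≡⟨ ℚ.+-identityˡ _ ⟨
      0ℚ ℚ.+ ι (2 * suc b)
          ≤⟨ ℚ.+-monoˡ-≤ (ι (2 * suc b)) (toWitness {a? = 0ℚ ℚ.≤? (ℤ.+ 9 / 25)} tt) ⟩
      (ℤ.+ 9 / 25) ℚ.+ ι (2 * suc b)  ∎
      where
      𝟙≤1 : ∀ b → 𝟙 b ≤ 1
      𝟙≤1 false = z≤n
      𝟙≤1 true  = ≤-refl

  -- The cost of each labelling bounds `γₜ G`, hence so does the mean cost. Multiplying by 25 clears
  -- the denominator of 9/25; the 50 is 25 times the cost 2, and `6 ^ K` bounds the walks by which
  -- one cycle is charged.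
  γₜ-bound : ∀ {K} → 15 ≤ K → 25 * γₜ G ≤ 9 * n + 50 * 6 ^ K * shortCycles K (matrix G)
  γₜ-bound {K} 15≤K = ≤-trans (ι-cancel-≤ scaled) (+-monoʳ-≤ (9 * n) (begin
    25 * ∑ (allFin n) (λ v → 2 * cyclesNear K v)     ≡⟨ cong (25 *_) (∑-*ˡ (allFin n) 2 _) ⟩
    25 * (2 * ∑ (allFin n) (cyclesNear K))           ≤⟨ *-monoʳ-≤ 25 (*-monoʳ-≤ 2 (∑-cyclesNear K)) ⟩
    25 * (2 * (shortCycles K (matrix G) * 6 ^ K))    ≡⟨ lem (shortCycles K (matrix G)) (6 ^ K) ⟩
    50 * 6 ^ K * shortCycles K (matrix G)            ∎))
    where
    open ≤-Reasoning
    lem : ∀ s x → 25 * (2 * (s * x)) ≡ 50 * x * s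
    lem = solve-∀
    b : ℕ
    b = ∑ (allFin n) (λ v → 2 * cyclesNear K v)
    average : ι (γₜ G) ℚ.≤ ι n ℚ.* (ℤ.+ 9 / 25) ℚ.+ ι b
    average = ℚ.≤-trans (ℚ.≤-reflexive (sym (𝔼-const n (γₜ G)))) (ℚ.≤-trans (𝔼-mono γₜ-≤-cost)
      (ℚ.≤-trans (𝔼-∑-≤ (allFin n) cost (ℤ.+ 9 / 25) (λ v → 2 * cyclesNear K v) (𝔼-cost-≤ 15≤K))
        (ℚ.≤-reflexive (cong (λ l → ι l ℚ.* (ℤ.+ 9 / 25) ℚ.+ ι b)
            (List.length-tabulate {n = n} id)))))
    scaled : ι (25 * γₜ G) ℚ.≤ ι (9 * n + 25 * b)
    scaled = ℚ.≤-trans (ℚ.≤-reflexive (ι-* 25 (γₜ G)))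
      (ℚ.≤-trans (ℚ.*-monoˡ-≤-nonNeg (ι 25) average) (ℚ.≤-reflexive (trans
        (solve 4 (λ t x q y → t :* (x :* q :+ y) := (t :* q) :* x :+ t :* y) refl (ι 25) (ι n)
            (ℤ.+ 9 / 25) (ι b))
        (trans (cong₂ ℚ._+_ (sym (ι-* 9 n)) (sym (ι-* 25 b))) (sym (ι-+ (9 * n) (25 * b)))))))
      where open +-*-Solver

𝟙-≤ : ∀ {b m} → (b ≡ true → 1 ≤ m) → 𝟙 b ≤ m
𝟙-≤ {false} b⇒ = z≤n
𝟙-≤ {true}  b⇒ = b⇒ refl

𝟙-does-≤ : ∀ {P : Set} (P? : Dec P) {m} → (P → 1 ≤ m) → 𝟙 (does P?) ≤ m
𝟙-does-≤ (yes p) P⇒ = P⇒ p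
𝟙-does-≤ (no  _) P⇒ = z≤n

𝟙-does-yes : ∀ {P : Set} (P? : Dec P) → P → 1 ≤ 𝟙 (does P?)
𝟙-does-yes P? p = ≤-reflexive (sym (cong 𝟙 (dec-true P? p)))

𝟙-yes : ∀ {b} → b ≡ true → 1 ≤ 𝟙 b
𝟙-yes refl = ≤-refl

-- Switchings

matrices : ∀ n → List (AdjMatrix n)
matrices n = allVecs (allSubsets n) n

entry : AdjMatrix n → Fin n → Fin n → Bool
entry M x y = lookup (lookup M x) y

-- That `φ` permutes `xs` is expressed through sums, which is also the form of the conclusion. So
-- the lemma can be applied to its own result: to an entry of a row, and then to a row of a matrix.
∑-updateAt : ∀ {xs : List A} {φ : A → A} → (∀ f → ∑ xs (f ∘ φ) ≡ ∑ xs f) →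
             ∀ {n} (i : Fin n) f → ∑ (allVecs xs n) (λ v → f (updateAt v i φ)) ≡ ∑ (allVecs xs n) f
∑-updateAt {xs = xs} {φ} inv {suc n} zero f = begin
  ∑ (allVecs xs (suc n)) (λ v → f (updateAt v zero φ))      ≡⟨ ∑-cartesianProductWith _∷_ xs _ _ ⟩
  ∑ xs (λ x → ∑ (allVecs xs n) (λ v → f (φ x ∷ v)))
      ≡⟨ inv (λ x → ∑ (allVecs xs n) (λ v → f (x ∷ v))) ⟩
  ∑ xs (λ x → ∑ (allVecs xs n) (λ v → f (x ∷ v)))           ≡⟨ ∑-cartesianProductWith _∷_ xs _ f ⟨
  ∑ (allVecs xs (suc n)) f                                  ∎
  where open ≡-Reasoning
∑-updateAt {xs = xs} {φ} inv {suc n} (suc i) f = begin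
  ∑ (allVecs xs (suc n)) (λ v → f (updateAt v (suc i) φ))
      ≡⟨ ∑-cartesianProductWith _∷_ xs _ _ ⟩
  ∑ xs (λ x → ∑ (allVecs xs n) (λ v → f (x ∷ updateAt v i φ)))
      ≡⟨ ∑-cong xs (λ x → ∑-updateAt inv i (λ v → f (x ∷ v))) ⟩
  ∑ xs (λ x → ∑ (allVecs xs n) (λ v → f (x ∷ v)))
      ≡⟨ ∑-cartesianProductWith _∷_ xs _ f ⟨
  ∑ (allVecs xs (suc n)) f                                         ∎
  where open ≡-Reasoning

-- Toggling entries permutes all Boolean matrices, whether or not the edge is present. A switching
-- made of toggles is therefore bijective by construction, and regularity is checked separately.
flipEntry flip : Fin n → Fin n → AdjMatrix n → AdjMatrix n
flipEntry i j M = updateAt M i (λ S → updateAt S j not)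
flip i j M = flipEntry i j (flipEntry j i M)

∑-flip : ∀ (i j : Fin n) f → ∑ (matrices n) (f ∘ flip i j) ≡ ∑ (matrices n) f
∑-flip {n} i j f = trans (∑-flipEntry j i (f ∘ flipEntry i j)) (∑-flipEntry i j f)
  where
  not-invariant : ∀ f → ∑ (outside ∷ inside ∷ []) (f ∘ not) ≡ ∑ (outside ∷ inside ∷ []) f
  not-invariant f = lem (f true) (f false)
    where
    lem : ∀ a b → a + (b + 0) ≡ b + (a + 0)
    lem = solve-∀
  ∑-flipEntry : ∀ (i j : Fin n) f → ∑ (matrices n) (f ∘ flipEntry i j) ≡ ∑ (matrices n) f
  ∑-flipEntry i j = ∑-updateAt (∑-updateAt not-invariant j) i

row-flip-i : ∀ {i j : Fin n} M → i ≢ j → lookup (flip i j M) i ≡ updateAt (lookup M i) j not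
row-flip-i {i = i} {j} M i≢j = trans (lookup∘updateAt i (flipEntry j i M))
    (cong (λ S → updateAt S j not) (lookup∘updateAt′ i j i≢j M))

row-flip-j : ∀ {i j : Fin n} M → i ≢ j → lookup (flip i j M) j ≡ updateAt (lookup M j) i not
row-flip-j {i = i} {j} M i≢j = trans (lookup∘updateAt′ j i (i≢j ∘ sym) (flipEntry j i M))
    (lookup∘updateAt j M)

row-flip-other : ∀ {i j x : Fin n} M → x ≢ i → x ≢ j → lookup (flip i j M) x ≡ lookup M x
row-flip-other {i = i} {j} {x} M x≢i x≢j = trans (lookup∘updateAt′ x i x≢i (flipEntry j i M))
    (lookup∘updateAt′ x j x≢j M)

flip-on : ∀ {i j : Fin n} M → i ≢ j → entry (flip i j M) i j ≡ not (entry M i j)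
flip-on {i = i} {j} M i≢j = trans (cong (λ S → lookup S j) (row-flip-i M i≢j))
    (lookup∘updateAt j (lookup M i))

flip-off : ∀ {i j x y : Fin n} M → i ≢ j → ¬ (x ≡ i × y ≡ j) → ¬ (x ≡ j × y ≡ i) →
           entry (flip i j M) x y ≡ entry M x y
flip-off {i = i} {j} {x} {y} M i≢j ≢ij ≢ji with x Fin.≟ i | x Fin.≟ j
... | yes refl | _ = trans (cong (λ S → lookup S y) (row-flip-i M i≢j))
                           (lookup∘updateAt′ y j (λ y≡j → ≢ij (refl , y≡j)) (lookup M x))
... | no _     | yes refl = trans (cong (λ S → lookup S y) (row-flip-j M i≢j))
                           (lookup∘updateAt′ y i (λ y≡i → ≢ji (refl , y≡i)) (lookup M x))
... | no x≢i   | no x≢j = cong (λ S → lookup S y) (row-flip-other M x≢i x≢j)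

Symmetric Loopless : AdjMatrix n → Set
Symmetric M = ∀ x y → entry M x y ≡ entry M y x
Loopless  M = ∀ x → entry M x x ≡ false

flip-symmetric : ∀ {i j : Fin n} M → i ≢ j → Symmetric M → Symmetric (flip i j M)
flip-symmetric {i = i} {j} M i≢j s x y
  with (x Fin.≟ i) ×-dec (y Fin.≟ j) | (x Fin.≟ j) ×-dec (y Fin.≟ i)
... | yes (refl , refl) | _ = on-pair
  where
  on-pair : entry (flip i j M) i j ≡ entry (flip i j M) j i
  on-pair = trans (flip-on M i≢j) (trans (cong not (s i j))
    (sym (trans (cong (λ S → lookup S i) (row-flip-j M i≢j)) (lookup∘updateAt i (lookup M j)))))
... | no _ | yes (refl , refl) = sym (trans (flip-on M i≢j) (trans (cong not (s i j))
    (sym (trans (cong (λ S → lookup S i) (row-flip-j M i≢j)) (lookup∘updateAt i (lookup M j))))))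
... | no ≢ij | no ≢ji = trans (flip-off M i≢j ≢ij ≢ji)
  (trans (s x y) (sym (flip-off M i≢j (λ (y≡i , x≡j) → ≢ji (x≡j , y≡i))
      (λ (y≡j , x≡i) → ≢ij (x≡i , y≡j)))))

flip-loopless : ∀ {i j : Fin n} M → i ≢ j → Loopless M → Loopless (flip i j M)
flip-loopless M i≢j l x = trans
  (flip-off M i≢j (λ {(refl , refl) → i≢j refl}) (λ {(refl , refl) → i≢j refl})) (l x)

∣updateAt∣-true : ∀ (S : Subset n) j → lookup S j ≡ true → ∣ S ∣ ≡ suc ∣ updateAt S j not ∣
∣updateAt∣-true (true  ∷ S) zero    eq = refl
∣updateAt∣-true (true  ∷ S) (suc j) eq = cong suc (∣updateAt∣-true S j eq)
∣updateAt∣-true (false ∷ S) (suc j) eq = ∣updateAt∣-true S j eq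

∣updateAt∣-false : ∀ (S : Subset n) j → lookup S j ≡ false → ∣ updateAt S j not ∣ ≡ suc ∣ S ∣
∣updateAt∣-false (false ∷ S) zero    eq = refl
∣updateAt∣-false (true  ∷ S) (suc j) eq = cong suc (∣updateAt∣-false S j eq)
∣updateAt∣-false (false ∷ S) (suc j) eq = ∣updateAt∣-false S j eq

δ : Fin n → Fin n → ℕ
δ x y = 𝟙 (does (x Fin.≟ y))

-- The relation `P` lets one case analysis serve both the removal and the addition of an edge; its
-- last argument says how many ends of the edge are at `x`.
flip-degree : ∀ {i j : Fin n} M (P : ℕ → ℕ → ℕ → Set) → i ≢ j → (∀ m → P m m 0) →
  P ∣ lookup M i ∣ ∣ updateAt (lookup M i) j not ∣ 1 →
  P ∣ lookup M j ∣ ∣ updateAt (lookup M j) i not ∣ 1 →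
  ∀ x → P ∣ lookup M x ∣ ∣ lookup (flip i j M) x ∣ (δ x i + δ x j)
flip-degree {i = i} {j} M P i≢j P₀ Pi Pj x with x Fin.≟ i | x Fin.≟ j
... | yes refl | yes refl = contradiction refl i≢j
... | yes refl | no _     = subst (λ S → P ∣ lookup M i ∣ ∣ S ∣ 1) (sym (row-flip-i M i≢j)) Pi
... | no _     | yes refl = subst (λ S → P ∣ lookup M j ∣ ∣ S ∣ 1) (sym (row-flip-j M i≢j)) Pj
... | no x≢i   | no x≢j   = subst (λ S → P ∣ lookup M x ∣ ∣ S ∣ 0) (sym (row-flip-other M x≢i x≢j))
    (P₀ _)

degree-removed : ∀ {i j : Fin n} M → i ≢ j → Symmetric M → entry M i j ≡ true →
  ∀ x → ∣ lookup M x ∣ ≡ ∣ lookup (flip i j M) x ∣ + (δ x i + δ x j)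
degree-removed {i = i} {j} M i≢j s e = flip-degree M (λ a b c → a ≡ b + c) i≢j
    (λ m → sym (+-identityʳ m))
  (trans (∣updateAt∣-true (lookup M i) j e) (+-comm 1 _))
      (trans (∣updateAt∣-true (lookup M j) i (trans (s j i) e)) (+-comm 1 _))

degree-added : ∀ {i j : Fin n} M → i ≢ j → Symmetric M → entry M i j ≡ false →
  ∀ x → ∣ lookup (flip i j M) x ∣ ≡ ∣ lookup M x ∣ + (δ x i + δ x j)
degree-added {i = i} {j} M i≢j s e = flip-degree M (λ a b c → b ≡ a + c) i≢j
    (λ m → sym (+-identityʳ m))
  (trans (∣updateAt∣-false (lookup M i) j e) (+-comm 1 _))
      (trans (∣updateAt∣-false (lookup M j) i (trans (s j i) e)) (+-comm 1 _))

record Is5Regular (M : AdjMatrix n) : Set where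
  constructor mk5Regular
  field
    symm     : Symmetric M
    loopl    : Loopless M
    degree≡5 : ∀ v → ∣ lookup M v ∣ ≡ 5

is5Regular? : ∀ (M : AdjMatrix n) → Dec (Is5Regular M)
is5Regular? M = map′ (λ (s , l , d) → mk5Regular s l d) (λ (mk5Regular s l d) → s , l , d)
  (Fin.all? (λ x → Fin.all? λ y → entry M x y Bool.≟ entry M y x)
   ×-dec Fin.all? (λ x → entry M x x Bool.≟ false)
   ×-dec Fin.all? (λ v → ∣ lookup M v ∣ Data.Nat.≟ 5))

switch : Fin n → Fin n → Fin n → Fin n → AdjMatrix n → AdjMatrix n
switch u v a b = flip v b ∘ flip a b ∘ flip u a ∘ flip u v

∑-switch : ∀ (u v a b : Fin n) f → ∑ (matrices n) (f ∘ switch u v a b) ≡ ∑ (matrices n) f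
∑-switch u v a b f = trans (∑-flip u v (f ∘ flip v b ∘ flip a b ∘ flip u a))
  (trans (∑-flip u a (f ∘ flip v b ∘ flip a b)) (trans (∑-flip a b (f ∘ flip v b)) (∑-flip v b f)))

-- Removals and additions alternate. Before each flip the entry concerned must still have its
-- original value, which the inequalities guarantee by keeping the earlier flips away from it.
module Switch {u v a b : Fin n} {M : AdjMatrix n} (reg : Is5Regular M)
  (uv : entry M u v ≡ true) (ab : entry M a b ≡ true)
  (¬ua : entry M u a ≡ false) (¬vb : entry M v b ≡ false)
  (u≢v : u ≢ v) (a≢b : a ≢ b) (a≢u : a ≢ u) (a≢v : a ≢ v) (b≢u : b ≢ u) (b≢v : b ≢ v) where
  open Is5Regular reg

  M₁ M₂ M₃ M₄ : AdjMatrix n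
  M₁ = flip u v M
  M₂ = flip u a M₁
  M₃ = flip a b M₂
  M₄ = flip v b M₃

  u≢a : u ≢ a
  u≢a = a≢u ∘ sym
  v≢b : v ≢ b
  v≢b = b≢v ∘ sym

  M₁ua : entry M₁ u a ≡ false
  M₁ua = trans (flip-off M u≢v (a≢v ∘ proj₂) (u≢v ∘ proj₁)) ¬ua

  M₂ab : entry M₂ a b ≡ true
  M₂ab = trans (flip-off M₁ u≢a (a≢u ∘ proj₁) (b≢u ∘ proj₂))
      (trans (flip-off M u≢v (a≢u ∘ proj₁) (a≢v ∘ proj₁)) ab)

  M₃vb : entry M₃ v b ≡ false
  M₃vb = trans (flip-off M₂ a≢b (a≢v ∘ sym ∘ proj₁) (v≢b ∘ proj₁))
    (trans (flip-off M₁ u≢a (u≢v ∘ sym ∘ proj₁) (b≢u ∘ proj₂))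
      (trans (flip-off M u≢v (u≢v ∘ sym ∘ proj₁) (b≢u ∘ proj₂)) ¬vb))

  s₁ : Symmetric M₁
  s₁ = flip-symmetric M u≢v symm
  s₂ : Symmetric M₂
  s₂ = flip-symmetric M₁ u≢a s₁
  s₃ : Symmetric M₃
  s₃ = flip-symmetric M₂ a≢b s₂

  switched-regular : Is5Regular M₄
  switched-regular = mk5Regular (flip-symmetric M₃ v≢b s₃)
    (flip-loopless M₃ v≢b (flip-loopless M₂ a≢b (flip-loopless M₁ u≢a (flip-loopless M u≢v loopl))))
    λ x → trans (balance (δ x u) (δ x v) (δ x a) (δ x b) ∣ lookup M₁ x ∣ ∣ lookup M₃ x ∣
                  (degree-removed M u≢v symm uv x) (degree-added M₁ u≢a s₁ M₁ua x)
                  (degree-removed M₂ a≢b s₂ M₂ab x) (degree-added M₃ v≢b s₃ M₃vb x))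
                (degree≡5 x)
    where
    -- The term of `a` cancels, since the edge gained at `a` and the edge lost there are flipped one
    -- after the other.
    lem : ∀ u v a b d₁ d₃ → d₁ + (u + a) ≡ d₃ + (a + b) → d₃ + (v + b) ≡ d₁ + (u + v)
    lem u v a b d₁ d₃ eq = +-cancelʳ-≡ a _ _
        (trans (l₁ d₃ v b a) (trans (cong (_+ v) (sym eq)) (l₂ d₁ u a v)))
      where
      l₁ : ∀ d v b a → d + (v + b) + a ≡ d + (a + b) + v
      l₁ = solve-∀
      l₂ : ∀ d u a v → d + (u + a) + v ≡ d + (u + v) + a
      l₂ = solve-∀
    balance : ∀ u v a b d₁ d₃ {d₀ d₂ d₄} → d₀ ≡ d₁ + (u + v) → d₂ ≡ d₁ + (u + a) → d₂ ≡ d₃ + (a + b) →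
              d₄ ≡ d₃ + (v + b) → d₄ ≡ d₀
    balance u v a b d₁ d₃ e₁ e₂ e₃ e₄ = trans e₄ (trans (lem u v a b d₁ d₃ (trans (sym e₂) e₃))
        (sym e₁))

  switched-ua : entry M₄ u a ≡ true
  switched-ua = trans (flip-off M₃ v≢b (u≢v ∘ proj₁) (b≢u ∘ sym ∘ proj₁))
    (trans (flip-off M₂ a≢b (u≢a ∘ proj₁) (b≢u ∘ sym ∘ proj₁))
        (trans (flip-on M₁ u≢a) (cong not M₁ua)))

  switched-vb : entry M₄ v b ≡ true
  switched-vb = trans (flip-on M₃ v≢b) (cong not M₃vb)

  switched-other : ∀ {x y} → x ≢ a → y ≢ a → ¬ (x ≡ u × y ≡ v) → ¬ (x ≡ v × y ≡ u) →
                   ¬ (x ≡ v × y ≡ b) → ¬ (x ≡ b × y ≡ v) → entry M₄ x y ≡ entry M x y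
  switched-other x≢a y≢a ≢uv ≢vu ≢vb ≢bv = trans (flip-off M₃ v≢b ≢vb ≢bv)
    (trans (flip-off M₂ a≢b (x≢a ∘ proj₁) (y≢a ∘ proj₂))
      (trans (flip-off M₁ u≢a (y≢a ∘ proj₂) (x≢a ∘ proj₁)) (flip-off M u≢v ≢uv ≢vu)))

endpoint-∈ : ∀ (x : A) xs → endpoint x xs ∈ x ∷ xs
endpoint-∈ x []       = here refl
endpoint-∈ x (y ∷ ys) = there (endpoint-∈ y ys)

-- The cycle edge removed is the closing one, from the endpoint to `x`. It is enough to keep `a` off
-- the cycle, as then `ab` is no cycle edge; `b` may be an inner vertex of the path.
record Switchable (M : AdjMatrix n) (x : Fin n) (xs : List (Fin n)) (a b : Fin n) : Set where
  constructor mkSwitchable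
  field
    regular : Is5Regular M
    isCycle : IsCycle M x xs
    ab      : entry M a b ≡ true
    a∉      : a ∉ x ∷ xs
    ¬ua     : entry M (endpoint x xs) a ≡ false
    ¬xb     : entry M x b ≡ false
    x≢b     : x ≢ b

-- Only what is needed to bound the number of such configurations in a fixed graph: a path with one
-- new neighbour at each end.
record Switched (M : AdjMatrix n) (x : Fin n) (xs : List (Fin n)) (a b : Fin n) : Set where
  constructor mkSwitched
  field
    regular : Is5Regular M
    path    : Linked (Adj M) (x ∷ xs)
    ua      : entry M (endpoint x xs) a ≡ true
    xb      : entry M x b ≡ true

adj? : ∀ (M : AdjMatrix n) x y → Dec (Adj M x y)
adj? M x y = entry M x y Bool.≟ true

switchable? : ∀ (M : AdjMatrix n) x xs a b → Dec (Switchable M x xs a b)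
switchable? {n} M x xs a b = map′
  (λ (r , c , ab , a∉ , ua , xb , x≢b) → mkSwitchable r c ab a∉ ua xb x≢b)
  (λ (mkSwitchable r c ab a∉ ua xb x≢b) → r , c , ab , a∉ , ua , xb , x≢b)
  (is5Regular? M ×-dec isCycle? M x xs ×-dec adj? M a b ×-dec ¬? (a ∈? (x ∷ xs))
    ×-dec (entry M (endpoint x xs) a Bool.≟ false) ×-dec (entry M x b Bool.≟ false)
    ×-dec ¬? (x Fin.≟ b))
  where open DecMembership (Fin._≟_ {n}) using (_∈?_)

switched? : ∀ (M : AdjMatrix n) x xs a b → Dec (Switched M x xs a b)
switched? M x xs a b = map′ (λ (r , p , ua , xb) → mkSwitched r p ua xb)
    (λ (mkSwitched r p ua xb) → r , p , ua , xb)
  (is5Regular? M ×-dec linked? (adj? M) (x ∷ xs) ×-dec adj? M (endpoint x xs) a ×-dec adj? M x b)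

switchable⇒switched : ∀ {M : AdjMatrix n} {x xs a b} → Switchable M x xs a b →
                      Switched (switch (endpoint x xs) x a b M) x xs a b
switchable⇒switched {xs = []}     (mkSwitchable _ (mkIsCycle () _ _ _) _ _ _ _ _)
switchable⇒switched {xs = _ ∷ []} (mkSwitchable _ (mkIsCycle (s≤s ()) _ _ _) _ _ _ _ _)
switchable⇒switched {M = M} {x} {y ∷ z ∷ zs} {a} {b}
  (mkSwitchable reg (mkIsCycle long (x∉ ∷ y∉ ∷ uniq) (xy ∷ path) closes) ab a∉ ¬ua ¬xb x≢b) =
  mkSwitched S.switched-regular (trans first-edge xy ∷ away path (λ p∈ → a∉ ∘ there ∘ avoid p∈)
      (λ p∈ → All.lookup x∉ p∈ ∘ sym)) S.switched-ua S.switched-vb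
  where
  open Is5Regular reg
  u = endpoint z zs
  contradictory : ∀ {b} → b ≡ true → b ≡ false → ⊥
  contradictory refl ()
  u∈ : u ∈ z ∷ zs
  u∈ = endpoint-∈ z zs
  avoid : ∀ {p} → p ∈ y ∷ z ∷ zs → p ≡ a → a ∈ y ∷ z ∷ zs
  avoid p∈ refl = p∈
  u≢x : u ≢ x
  u≢x = All.lookup x∉ (there u∈) ∘ sym
  a≢b : a ≢ b
  a≢b refl = contradictory ab (loopl a)
  a≢u : a ≢ u
  a≢u refl = a∉ (there (there u∈))
  a≢x : a ≢ x
  a≢x refl = a∉ (here refl)
  b≢u : b ≢ u
  b≢u refl = contradictory (trans (symm u a) ab) ¬ua
  module S = Switch reg closes ab ¬ua ¬xb u≢x a≢b a≢u a≢x b≢u (x≢b ∘ sym)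
  -- This edge contains `x`, an end of the removed edge. It survives because the cycle has a third
  -- vertex, so that `y` differs from `u`.
  first-edge : entry (switch u x a b M) x y ≡ entry M x y
  first-edge = S.switched-other (λ {refl → a∉ (here refl)}) (λ {refl → a∉ (there (here refl))})
    (λ {(refl , refl) → All.lookup x∉ (here refl) refl}) (λ {(_ , y≡u) → All.lookup y∉ u∈ y≡u})
    (λ {(_ , refl) → contradictory xy ¬xb}) (λ {(x≡b , _) → x≢b x≡b})
  away : ∀ {ps} → Linked (Adj M) ps → (∀ {p} → p ∈ ps → p ≢ a) → (∀ {p} → p ∈ ps → p ≢ x) →
         Linked (Adj (switch u x a b M)) ps
  away []       ≢a ≢x = []
  away [-]      ≢a ≢x = [-]
  away (pq ∷ l) ≢a ≢x = trans
    (S.switched-other (≢a (here refl)) (≢a (there (here refl))) (≢x (there (here refl)) ∘ proj₂)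
        (≢x (here refl) ∘ proj₁)
      (≢x (here refl) ∘ proj₁) (≢x (there (here refl)) ∘ proj₂)) pq
    ∷ away l (≢a ∘ there) (≢x ∘ there)

-- Double counting of switchings.

module _ {M : AdjMatrix n} (reg : Is5Regular M) where
  open Is5Regular reg

  private
    V : List (Fin n)
    V = allFin n
    e : Fin n → Fin n → ℕ
    e a b = 𝟙 (entry M a b)

  row-sum : ∀ a → ∑ V (e a) ≡ 5
  row-sum a = trans (sym (trans (cong ∣_∣ (sym (tabulate∘lookup (lookup M a))))
      (∣tabulate∣ id (lookup (lookup M a))))) (degree≡5 a)

  ∑-edges-source : ∀ w → ∑ V (λ a → ∑ V (λ b → w a * e a b)) ≡ ∑ V w * 5
  ∑-edges-source w = trans (∑-cong V (λ a → trans (∑-*ˡ V (w a) (e a)) (cong (w a *_) (row-sum a))))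
      (∑-*ʳ V 5 w)

  ∑-edges-target : ∀ w → ∑ V (λ a → ∑ V (λ b → w b * e a b)) ≡ ∑ V w * 5
  ∑-edges-target w = trans (∑-swap V V _)
    (trans (∑-cong V (λ b → ∑-cong V (λ a → cong (λ c → w b * 𝟙 c) (symm a b)))) (∑-edges-source w))

  ∑-members : ∀ (xs : List (Fin n)) → ∑ V (λ a → ∑ xs (λ z → δ z a)) ≡ length xs
  ∑-members xs = trans (∑-swap V xs _)
      (trans (∑-cong xs ∑-𝟙-≟) (trans (∑-const xs 1) (*-identityʳ _)))

  -- Among the `5 * n` oriented edges `ab`, at most `5 * suc (length xs)` have `a` on the cycle, 25
  -- have `a` adjacent to the endpoint, 25 have `b` adjacent to `x`, and 5 have `b` equal to `x`.
  -- All others can be switched.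
  enough-switchings : ∀ {x xs} → IsCycle M x xs → 5 * length xs + 60 ≤ n →
                      n ≤ ∑ V (λ a → ∑ V (λ b → 𝟙 (does (switchable? M x xs a b))))
  enough-switchings {x} {xs} cyc large = +-cancelʳ-≤ n _ _ (begin
    n + n                                        ≤⟨ m≤m+n (n + n) (3 * n) ⟩
    n + n + 3 * n                                ≡⟨ lem₁ n ⟩
    n * 5                                        ≡⟨ cong (_* 5) (List.length-tabulate {n = n} id) ⟨
    length V * 5                                 ≡⟨ ∑-const V 5 ⟨
    ∑ V (λ _ → 5)                                ≡⟨ ∑-cong V row-sum ⟨
    ∑ V (λ a → ∑ V (λ b → e a b))                ≤⟨ ∑-mono V (λ a → ∑-mono V (classify a)) ⟩
    S (λ a b → sw a b + (f₁ a b + (f₂ a b + (f₃ a b + f₄ a b))))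
      ≡⟨ S-+ sw _ ⟩
    S sw + S (λ a b → f₁ a b + (f₂ a b + (f₃ a b + f₄ a b)))
      ≡⟨ cong (S sw +_) (trans (S-+ f₁ _)
          (cong₂ _+_ Sf₁ (trans (S-+ f₂ _)
          (cong₂ _+_ Sf₂ (trans (S-+ f₃ f₄) (cong₂ _+_ Sf₃ Sf₄)))))) ⟩
    S sw + (suc (length xs) * 5 + (25 + (25 + 5)))  ≡⟨ cong (S sw +_) (lem₂ (length xs)) ⟩
    S sw + (5 * length xs + 60)                     ≤⟨ +-monoʳ-≤ (S sw) large ⟩
    S sw + n                                        ∎)
    where
    open ≤-Reasoning
    open DecMembership (Fin._≟_ {n}) using (_∈?_)
    u = endpoint x xs
    S : (Fin n → Fin n → ℕ) → ℕ
    S f = ∑ V (λ a → ∑ V (f a))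
    S-+ : ∀ f g → S (λ a b → f a b + g a b) ≡ S f + S g
    S-+ f g = trans (∑-cong V (λ a → ∑-+ V (f a) (g a))) (∑-+ V _ _)
    lem₁ : ∀ n → n + n + 3 * n ≡ n * 5
    lem₁ = solve-∀
    lem₂ : ∀ l → suc l * 5 + (25 + (25 + 5)) ≡ 5 * l + 60
    lem₂ = solve-∀
    sw f₁ f₂ f₃ f₄ : Fin n → Fin n → ℕ
    sw a b = 𝟙 (does (switchable? M x xs a b))
    f₁ a b = ∑ (x ∷ xs) (λ z → δ z a) * e a b
    f₂ a b = e u a * e a b
    f₃ a b = e x b * e a b
    f₄ a b = δ x b * e a b
    Sf₁ : S f₁ ≡ suc (length xs) * 5
    Sf₁ = trans (∑-edges-source _) (cong (_* 5) (∑-members (x ∷ xs)))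
    Sf₂ : S f₂ ≡ 25
    Sf₂ = trans (∑-edges-source (e u)) (cong (_* 5) (row-sum u))
    Sf₃ : S f₃ ≡ 25
    Sf₃ = trans (∑-edges-target (e x)) (cong (_* 5) (row-sum x))
    Sf₄ : S f₄ ≡ 5
    Sf₄ = trans (∑-edges-target (δ x)) (cong (_* 5) (∑-𝟙-≟ x))
    classify : ∀ a b → e a b ≤ sw a b + (f₁ a b + (f₂ a b + (f₃ a b + f₄ a b)))
    classify a b = 𝟙-≤ λ ab → by-cases ab (a ∈? (x ∷ xs)) (adj? M u a) (adj? M x b) (x Fin.≟ b)
      where
      by-cases : entry M a b ≡ true → Dec (a ∈ x ∷ xs) → Dec (Adj M u a) → Dec (Adj M x b) →
                 Dec (x ≡ b) →
                 1 ≤ sw a b + (f₁ a b + (f₂ a b + (f₃ a b + f₄ a b)))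
      by-cases ab (yes a∈) _ _ _ = m≤n⇒m≤o+n (sw a b)
          (m≤n⇒m≤n+o _ (*-mono-≤ (≤-trans (𝟙-does-yes (a Fin.≟ a) refl) (∑-∈ (λ z → δ z a) a∈))
          (𝟙-yes ab)))
      by-cases ab (no _) (yes ua) _ _ = m≤n⇒m≤o+n (sw a b)
          (m≤n⇒m≤o+n (f₁ a b) (m≤n⇒m≤n+o _ (*-mono-≤ (𝟙-yes ua) (𝟙-yes ab))))
      by-cases ab (no _) (no _) (yes xb) _ = m≤n⇒m≤o+n (sw a b)
          (m≤n⇒m≤o+n (f₁ a b) (m≤n⇒m≤o+n (f₂ a b) (m≤n⇒m≤n+o _ (*-mono-≤ (𝟙-yes xb) (𝟙-yes ab)))))
      by-cases ab (no _) (no _) (no _) (yes x≡b) = m≤n⇒m≤o+n (sw a b)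
          (m≤n⇒m≤o+n (f₁ a b) (m≤n⇒m≤o+n (f₂ a b)
          (m≤n⇒m≤o+n (f₃ a b) (*-mono-≤ (𝟙-does-yes (x Fin.≟ b) x≡b) (𝟙-yes ab)))))
      by-cases ab (no a∉) (no ¬ua) (no ¬xb) (no x≢b) = m≤n⇒m≤n+o _
          (𝟙-does-yes (switchable? M x xs a b)
        (mkSwitchable reg cyc ab a∉ (Bool.¬-not ¬ua) (Bool.¬-not ¬xb) x≢b))

  ∑-paths : ∀ k x → ∑ (tuples n k) (λ xs → 𝟙 (does (linked? (adj? M) (x ∷ xs)))) ≤ 5 ^ k
  ∑-paths zero    x = ≤-refl
  ∑-paths (suc k) x = begin
    ∑ (tuples n (suc k)) (λ xs → L x xs)
        ≡⟨ ∑-cartesianProductWith _∷_ V (tuples n k) (L x) ⟩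
    ∑ V (λ y → ∑ (tuples n k) (λ ys → L x (y ∷ ys)))
        ≤⟨ ∑-mono V (λ y → ∑-mono (tuples n k) (λ ys → 𝟙-does-≤ (linked? (adj? M) (x ∷ y ∷ ys)) λ l →
             *-mono-≤ (𝟙-yes (Linked.head l))
                      (𝟙-does-yes (linked? (adj? M) (y ∷ ys)) (Linked.tail l)))) ⟩
    ∑ V (λ y → ∑ (tuples n k) (λ ys → e x y * L y ys))
        ≡⟨ ∑-cong V (λ y → ∑-*ˡ (tuples n k) (e x y) (L y)) ⟩
    ∑ V (λ y → e x y * ∑ (tuples n k) (L y))
        ≤⟨ ∑-mono V (λ y → *-monoʳ-≤ (e x y) (∑-paths k y)) ⟩
    ∑ V (λ y → e x y * 5 ^ k)                             ≡⟨ ∑-*ʳ V (5 ^ k) (e x) ⟩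
    ∑ V (e x) * 5 ^ k                                     ≡⟨ cong (_* 5 ^ k) (row-sum x) ⟩
    5 ^ suc k                                             ∎
    where
    open ≤-Reasoning
    L : Fin n → List (Fin n) → ℕ
    L x xs = 𝟙 (does (linked? (adj? M) (x ∷ xs)))

∑-configs : ∀ n → ℕ → (Fin n → List (Fin n) → Fin n → Fin n → ℕ) → ℕ
∑-configs n k f = ∑ (allFin n) λ x → ∑ (tuples n k) λ xs →
  ∑ (allFin n) λ a → ∑ (allFin n) λ b → f x xs a b

∑-configs-mono : ∀ k {f g} → (∀ x xs a b → f x xs a b ≤ g x xs a b) →
                 ∑-configs n k f ≤ ∑-configs n k g
∑-configs-mono {n} k f≤g = ∑-mono (allFin n) λ x → ∑-mono (tuples n k) λ xs →
  ∑-mono (allFin n) λ a → ∑-mono (allFin n) λ b → f≤g x xs a b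

∑-configs-swap : ∀ k (ms : List A) (f : A → _) →
  ∑ ms (λ m → ∑-configs n k (f m)) ≡ ∑-configs n k (λ x xs a b → ∑ ms (λ m → f m x xs a b))
∑-configs-swap {n = n} k ms f = trans (∑-swap ms V _) (∑-cong V λ x →
  trans (∑-swap ms (tuples n k) _) (∑-cong (tuples n k) λ xs →
  trans (∑-swap ms V _) (∑-cong V λ a → ∑-swap ms V _)))
  where V = allFin n

-- In a regular graph there are `n` roots, at most `5 ^ k` paths from each, and 5 neighbours to
-- choose from at either end.
∑-switched : ∀ k (M : AdjMatrix n) →
  ∑-configs n k (λ x xs a b → 𝟙 (does (switched? M x xs a b)))
  ≤ 𝟙 (does (is5Regular? M)) * (n * (5 ^ k * 25))
∑-switched {n} k M = by-cases (is5Regular? M)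
  where
  open ≤-Reasoning
  V = allFin n
  e : Fin n → Fin n → ℕ
  e a b = 𝟙 (entry M a b)
  L : Fin n → List (Fin n) → ℕ
  L x xs = 𝟙 (does (linked? (adj? M) (x ∷ xs)))
  by-cases : (d : Dec (Is5Regular M)) → ∑-configs n k (λ x xs a b → 𝟙 (does (switched? M x xs a b)))
      ≤ 𝟙 (does d) * (n * (5 ^ k * 25))
  by-cases (no ¬reg) = begin
    ∑-configs n k (λ x xs a b → 𝟙 (does (switched? M x xs a b)))
      ≤⟨ ∑-configs-mono k (λ x xs a b → 𝟙-does-≤ (switched? M x xs a b)
          (λ s → contradiction (Switched.regular s) ¬reg)) ⟩
    ∑-configs n k (λ x xs a b → 0)
      ≡⟨ ∑-zero V (λ _ → ∑-zero (tuples n k) (λ _ → ∑-zero V (λ _ → ∑-zero V (λ _ → refl)))) ⟩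
    0 ∎
  by-cases (yes reg) = begin
    ∑-configs n k (λ x xs a b → 𝟙 (does (switched? M x xs a b)))
      ≤⟨ ∑-configs-mono k (λ x xs a b → 𝟙-does-≤ (switched? M x xs a b) λ (mkSwitched _ l ua xb) →
           *-mono-≤ (𝟙-does-yes (linked? (adj? M) (x ∷ xs)) l) (*-mono-≤ (𝟙-yes ua) (𝟙-yes xb))) ⟩
    ∑-configs n k (λ x xs a b → L x xs * (e (endpoint x xs) a * e x b))
      ≡⟨ ∑-cong V (λ x → ∑-cong (tuples n k) (λ xs → ends x xs)) ⟩
    ∑ V (λ x → ∑ (tuples n k) (λ xs → L x xs * 25))   ≡⟨ ∑-cong V (λ x → ∑-*ʳ (tuples n k) 25 (L x)) ⟩
    ∑ V (λ x → ∑ (tuples n k) (L x) * 25)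
        ≤⟨ ∑-mono V (λ x → *-monoˡ-≤ 25 (∑-paths reg k x)) ⟩
    ∑ V (λ x → 5 ^ k * 25)
        ≡⟨ trans (∑-const V _) (cong (_* (5 ^ k * 25)) (List.length-tabulate {n = n} id)) ⟩
    n * (5 ^ k * 25)                                  ≡⟨ *-identityˡ _ ⟨
    1 * (n * (5 ^ k * 25))                            ∎
    where
    ends : ∀ x xs → ∑ V (λ a → ∑ V (λ b → L x xs * (e (endpoint x xs) a * e x b))) ≡ L x xs * 25
    ends x xs = begin-equality
      ∑ V (λ a → ∑ V (λ b → L x xs * (e u a * e x b)))
          ≡⟨ ∑-cong V (λ a → trans (∑-*ˡ V (L x xs) _)
          (cong (L x xs *_) (trans (∑-*ˡ V (e u a) (e x)) (cong (e u a *_) (row-sum reg x))))) ⟩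
      ∑ V (λ a → L x xs * (e u a * 5))
          ≡⟨ trans (∑-*ˡ V (L x xs) _)
          (cong (L x xs *_) (trans (∑-*ʳ V 5 (e u)) (cong (_* 5) (row-sum reg u)))) ⟩
      L x xs * 25 ∎
      where u = endpoint x xs

∈-tuples⁻ : ∀ {k} {xs : List (Fin n)} → xs ∈ tuples n k → length xs ≡ k
∈-tuples⁻ {k = zero}  (here refl) = refl
∈-tuples⁻ {n} {k = suc k} xs∈ with _ , ys , _ , ys∈ , refl ← ∈-cartesianProductWith⁻ _∷_ (allFin n)
    (tuples n k) xs∈ = cong suc (∈-tuples⁻ ys∈)

regularCount : ℕ → ℕ
regularCount n = ∑ (matrices n) (λ M → 𝟙 (does (is5Regular? M)))

cycleCount : ∀ {n} → ℕ → AdjMatrix n → ℕ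
cycleCount {n} k M = ∑ (allFin n) λ x → ∑ (tuples n k) λ xs → 𝟙 (does (isCycle? M x xs))

-- Exchanging the sums fixes the configuration first, and for a fixed configuration the switching
-- permutes the matrices. The `n` switchings per cycle cancel against the `n` roots in `∑-switched`,
-- which leaves a mean bounded independently of `n`.
∑-cycleCount : ∀ k → 5 * k + 60 ≤ n →
  ∑ (matrices n) (λ M → 𝟙 (does (is5Regular? M)) * cycleCount k M) ≤ 5 ^ k * 25 * regularCount n
∑-cycleCount {n} k large = *-cancelˡ-≤ n
    {{>-nonZero (≤-trans (s≤s z≤n) (≤-trans (m≤n+m 60 (5 * k)) large))}} (begin
  n * ∑ Ms (λ M → r M * cycleCount k M)        ≡⟨ ∑-*ˡ Ms n _ ⟨
  ∑ Ms (λ M → n * (r M * cycleCount k M))      ≤⟨ ∑-mono Ms per-matrix ⟩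
  ∑ Ms (λ M → ∑-configs n k (sw M))            ≡⟨ ∑-configs-swap k Ms sw ⟩
  ∑-configs n k (λ x xs a b → ∑ Ms (λ M → sw M x xs a b))
    ≤⟨ ∑-configs-mono k (λ x xs a b → ∑-mono Ms (λ M → 𝟙-does-≤ (switchable? M x xs a b)
        (𝟙-does-yes (switched? _ x xs a b) ∘ switchable⇒switched))) ⟩
  ∑-configs n k (λ x xs a b → ∑ Ms (λ M → st (switch (endpoint x xs) x a b M) x xs a b))
    ≤⟨ ∑-configs-mono k (λ x xs a b → ≤-reflexive
        (∑-switch (endpoint x xs) x a b (λ M → st M x xs a b))) ⟩
  ∑-configs n k (λ x xs a b → ∑ Ms (λ M → st M x xs a b))  ≡⟨ ∑-configs-swap k Ms st ⟨
  ∑ Ms (λ M → ∑-configs n k (st M))            ≤⟨ ∑-mono Ms (∑-switched k) ⟩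
  ∑ Ms (λ M → r M * (n * (5 ^ k * 25)))        ≡⟨ ∑-*ʳ Ms (n * (5 ^ k * 25)) r ⟩
  regularCount n * (n * (5 ^ k * 25))          ≡⟨ lem (regularCount n) n (5 ^ k * 25) ⟩
  n * (5 ^ k * 25 * regularCount n)            ∎)
  where
  open ≤-Reasoning
  lem : ∀ g n c → g * (n * c) ≡ n * (c * g)
  lem = solve-∀
  V = allFin n
  Ms = matrices n
  r : AdjMatrix n → ℕ
  r M = 𝟙 (does (is5Regular? M))
  sw st : AdjMatrix n → Fin n → List (Fin n) → Fin n → Fin n → ℕ
  sw M x xs a b = 𝟙 (does (switchable? M x xs a b))
  st M x xs a b = 𝟙 (does (switched? M x xs a b))
  per-tuple : ∀ {M} → Is5Regular M → ∀ x xs → length xs ≡ k → (d : Dec (IsCycle M x xs)) →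
              n * 𝟙 (does d) ≤ ∑ V (λ a → ∑ V (sw M x xs a))
  per-tuple reg x xs refl (no  _) = ≤-trans (≤-reflexive (*-zeroʳ n)) z≤n
  per-tuple reg x xs refl (yes c) = ≤-trans (≤-reflexive (*-identityʳ n))
      (enough-switchings reg c large)
  regular-case : ∀ M → (d : Dec (Is5Regular M)) →
                 n * (𝟙 (does d) * cycleCount k M) ≤ ∑-configs n k (sw M)
  regular-case M (no  _)   = ≤-trans (≤-reflexive (*-zeroʳ n)) z≤n
  regular-case M (yes reg) = begin
    n * (1 * cycleCount k M)                           ≡⟨ cong (n *_) (*-identityˡ _) ⟩
    n * cycleCount k M
        ≡⟨ trans (∑-cong V (λ x → ∑-*ˡ (tuples n k) n _)) (∑-*ˡ V n _) ⟨
    ∑ V (λ x → ∑ (tuples n k) (λ xs → n * 𝟙 (does (isCycle? M x xs))))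
      ≤⟨ ∑-mono V (λ x → ∑-mono-∈ (tuples n k) (λ {xs} xs∈ → per-tuple reg x xs (∈-tuples⁻ xs∈)
          (isCycle? M x xs))) ⟩
    ∑-configs n k (sw M) ∎
  per-matrix : ∀ M → n * (r M * cycleCount k M) ≤ ∑-configs n k (sw M)
  per-matrix M = regular-case M (is5Regular? M)

∑-shortCycles : ∀ K → 5 * K + 60 ≤ n →
  ∑ (matrices n) (λ M → 𝟙 (does (is5Regular? M)) * shortCycles K M)
  ≤ ∑ (upTo (suc K)) (λ k → 5 ^ k * 25) * regularCount n
∑-shortCycles {n} K large = begin
  ∑ Ms (λ M → r M * ∑ ks (λ k → cycleCount k M))
      ≡⟨ ∑-cong Ms (λ M → ∑-*ˡ ks (r M) (λ k → cycleCount k M)) ⟨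
  ∑ Ms (λ M → ∑ ks (λ k → r M * cycleCount k M))       ≡⟨ ∑-swap Ms ks _ ⟩
  ∑ ks (λ k → ∑ Ms (λ M → r M * cycleCount k M))
      ≤⟨ ∑-mono-∈ ks (λ {k} k∈ → ∑-cycleCount k
      (≤-trans (+-monoˡ-≤ 60 (*-monoʳ-≤ 5 (≤-pred (∈-upTo⁻ k∈)))) large)) ⟩
  ∑ ks (λ k → 5 ^ k * 25 * regularCount n)
      ≡⟨ ∑-*ʳ ks (regularCount n) (λ k → 5 ^ k * 25) ⟩
  ∑ ks (λ k → 5 ^ k * 25) * regularCount n             ∎
  where
  open ≤-Reasoning
  ks = upTo (suc K)
  Ms = matrices n
  r : AdjMatrix n → ℕ
  r M = 𝟙 (does (is5Regular? M))

-- Large girth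

lookup-injective : ∀ {xs : List A} → Unique xs → Injective _≡_ _≡_ (List.lookup xs)
lookup-injective (x∉ ∷ u) {zero}  {zero}  eq = refl
lookup-injective (x∉ ∷ u) {zero}  {suc j} eq = contradiction eq (All.lookup x∉ (∈-lookup j))
lookup-injective (x∉ ∷ u) {suc i} {zero}  eq = contradiction (sym eq) (All.lookup x∉ (∈-lookup i))
lookup-injective (x∉ ∷ u) {suc i} {suc j} eq = cong suc (lookup-injective u eq)

Linked-lookup : ∀ {R : A → A → Set} {x xs} → Linked R (x ∷ xs) → ∀ (i : Fin (length xs)) →
                R (List.lookup (x ∷ xs) (inject₁ i)) (List.lookup (x ∷ xs) (suc i))
Linked-lookup (Rxy ∷ l) zero    = Rxy
Linked-lookup (Rxy ∷ l) (suc i) = Linked-lookup l i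

lookup-fromℕ : ∀ (x : A) xs → List.lookup (x ∷ xs) (fromℕ (length xs)) ≡ endpoint x xs
lookup-fromℕ x []       = refl
lookup-fromℕ x (y ∷ ys) = lookup-fromℕ y ys

toCycle : ∀ {G : Graph n} {x xs} → IsCycle (matrix G) x xs → Cycle G (suc (length xs))
toCycle {G = G} {x} {xs} (mkIsCycle long distinct path closes) =
  cycle long (List.lookup (x ∷ xs)) (lookup-injective distinct)
    (λ i → lookup⇒[]= _ _ (Linked-lookup path i))
    (lookup⇒[]= _ _ (subst (λ z → Adj (matrix G) z x) (sym (lookup-fromℕ x xs)) closes))

-- `GirthAtLeast` speaks only of lengths of shortest cycles. Strong induction on the length shows
-- that a short cycle would be a shortest one.
no-short-cycle : ∀ {G : Graph n} {g} → GirthAtLeast G g → ∀ l → l < g → ¬ Cycle G l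
no-short-cycle {G = G} {g} girth = <-rec _ λ l shorter l<g c →
  <⇒≱ l<g (girth l (c , λ l′ c′ → ≮⇒≥ λ l′<l → shorter l′<l (<-trans l′<l l<g) c′))

-- The lists counted have at most `K` vertices besides the root, so the cycles have length at most
-- `1 + K`; hence girth `2 + K`.
shortCycles≡0 : ∀ {G : Graph n} {K} → GirthAtLeast G (2 + K) → shortCycles K (matrix G) ≡ 0
shortCycles≡0 {n} {G} {K} girth = ∑-zero (upTo (suc K)) λ {k} k∈ → ∑-zero (allFin n) λ {x} _ →
  ∑-zero (tuples n k) λ {xs} xs∈ → cong 𝟙 (dec-false (isCycle? (matrix G) x xs) λ c →
    no-short-cycle girth _ (s≤s (subst (_< suc K) (sym (∈-tuples⁻ xs∈)) (∈-upTo⁻ k∈)))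
        (toCycle {G = G} c))

γₜ-girth : ∀ {K} → 15 ≤ K → (G : Graph n) → Regular 5 G → GirthAtLeast G (2 + K) → 11 * γₜ G ≤ 4 * n
γₜ-girth {n} {K} 15≤K G reg girth = *-cancelˡ-≤ 25 (begin
  25 * (11 * γₜ G)                                          ≡⟨ lem₁ (γₜ G) ⟩
  11 * (25 * γₜ G)
      ≤⟨ *-monoʳ-≤ 11 (Unfolding.γₜ-bound G reg 15≤K) ⟩
  11 * (9 * n + 50 * 6 ^ K * shortCycles K (matrix G))
      ≡⟨ cong (λ s → 11 * (9 * n + 50 * 6 ^ K * s)) (shortCycles≡0 {G = G} girth) ⟩
  11 * (9 * n + 50 * 6 ^ K * 0)                             ≡⟨ lem₂ n (50 * 6 ^ K) ⟩
  -- This is the inequality 9/25 < 4/11 with denominators cleared.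
  99 * n                                                    ≤⟨ *-monoˡ-≤ n (≤ᵇ⇒≤ 99 100 tt) ⟩
  100 * n                                                   ≡⟨ lem₃ n ⟩
  25 * (4 * n)                                              ∎)
  where
  open ≤-Reasoning
  lem₁ : ∀ g → 25 * (11 * g) ≡ 11 * (25 * g)
  lem₁ = solve-∀
  lem₂ : ∀ n c → 11 * (9 * n + c * 0) ≡ 99 * n
  lem₂ = solve-∀
  lem₃ : ∀ n → 100 * n ≡ 25 * (4 * n)
  lem₃ = solve-∀

-- Existence of regular graphs

-- Used with `h` equal to half of `n`: the steps are 1 and 2 in both directions and the antipode. In
-- terms of the absolute difference the backward steps become `n ∸ 1` and `n ∸ 2`.
circulant : ∀ n → ℕ → AdjMatrix n
circulant n h = tabulate λ x → tabulate λ y → chord ∣ toℕ x - toℕ y ∣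
  where
  chord : ℕ → Bool
  chord d = (d ≡ᵇ 1) ∨ (d ≡ᵇ 2) ∨ (d ≡ᵇ h) ∨ (d ≡ᵇ n ∸ 2) ∨ (d ≡ᵇ n ∸ 1)

∣++outside∣ : ∀ (S : Subset n) m → ∣ S Vec.++ replicate m outside ∣ ≡ ∣ S ∣
∣++outside∣ []            zero    = refl
∣++outside∣ []            (suc m) = ∣++outside∣ [] m
∣++outside∣ (inside  ∷ S) m       = cong suc (∣++outside∣ S m)
∣++outside∣ (outside ∷ S) m       = ∣++outside∣ S m

∣outside++∣ : ∀ m (S : Subset n) → ∣ replicate m outside Vec.++ S ∣ ≡ ∣ S ∣
∣outside++∣ zero    S = refl
∣outside++∣ (suc m) S = ∣outside++∣ m S

module DisjointUnion {m n} (L : AdjMatrix m) (R : AdjMatrix n) where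

  left : Fin m → Subset (m + n)
  left i = lookup L i Vec.++ replicate n outside

  right : Fin n → Subset (m + n)
  right j = replicate m outside Vec.++ lookup R j

  union : AdjMatrix (m + n)
  union = tabulate λ x → [ left , right ]′ (splitAt m x)

  block : Fin m ⊎ Fin n → Fin m ⊎ Fin n → Bool
  block (inj₁ i) (inj₁ i′) = entry L i i′
  block (inj₁ i) (inj₂ j)  = false
  block (inj₂ j) (inj₁ i)  = false
  block (inj₂ j) (inj₂ j′) = entry R j j′

  entry-union : ∀ x y → entry union x y ≡ block (splitAt m x) (splitAt m y)
  entry-union x y = trans (cong (λ S → lookup S y) (lookup∘tabulate _ x)) (by-block (splitAt m x))
    where
    by-block : ∀ s → lookup ([ left , right ]′ s) y ≡ block s (splitAt m y)
    by-block (inj₁ i) with splitAt m y | lookup-splitAt m (lookup L i) (replicate n outside) y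
    ... | inj₁ i′ | eq = eq
    ... | inj₂ j  | eq = trans eq (lookup-replicate j outside)
    by-block (inj₂ j) with splitAt m y | lookup-splitAt m (replicate m outside) (lookup R j) y
    ... | inj₁ i  | eq = trans eq (lookup-replicate i outside)
    ... | inj₂ j′ | eq = eq

  union-regular : Is5Regular L → Is5Regular R → Is5Regular union
  union-regular regL regR = mk5Regular
    (λ x y → trans (entry-union x y) (trans (block-sym (splitAt m x) (splitAt m y))
        (sym (entry-union y x))))
    (λ x → trans (entry-union x x) (block-irrefl (splitAt m x)))
    (λ x → trans (cong ∣_∣ (lookup∘tabulate _ x)) (row-degree (splitAt m x)))
    where
    module L = Is5Regular regL
    module R = Is5Regular regR
    block-sym : ∀ s t → block s t ≡ block t s
    block-sym (inj₁ i) (inj₁ i′) = L.symm i i′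
    block-sym (inj₁ i) (inj₂ j)  = refl
    block-sym (inj₂ j) (inj₁ i)  = refl
    block-sym (inj₂ j) (inj₂ j′) = R.symm j j′
    block-irrefl : ∀ s → block s s ≡ false
    block-irrefl (inj₁ i) = L.loopl i
    block-irrefl (inj₂ j) = R.loopl j
    row-degree : ∀ s → ∣ [ left , right ]′ s ∣ ≡ 5
    row-degree (inj₁ i) = trans (∣++outside∣ (lookup L i) n) (L.degree≡5 i)
    row-degree (inj₂ j) = trans (∣outside++∣ m (lookup R j)) (R.degree≡5 j)

-- Orders 6, 8 and 10 start the recursion, and adding a disjoint complete graph on 6 vertices moves
-- three even orders ahead. The order is written so that it reduces to the one of the union.
regularMatrix : ∀ m → ∃[ M ] Is5Regular {(3 + m) * 2} M
regularMatrix 0 = circulant 6 3  , toWitness {a? = is5Regular? (circulant 6 3)} tt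
regularMatrix 1 = circulant 8 4  , toWitness {a? = is5Regular? (circulant 8 4)} tt
regularMatrix 2 = circulant 10 5 , toWitness {a? = is5Regular? (circulant 10 5)} tt
regularMatrix (suc (suc (suc m))) =
  let M , reg = regularMatrix m in
  DisjointUnion.union (circulant 6 3) M ,
  DisjointUnion.union-regular (circulant 6 3) M (toWitness {a? = is5Regular? (circulant 6 3)} tt) reg

-- Without a regular graph `uniformProb` would be 0, so convergence to 1 needs this.
regularCount-positive : ∀ {n} → 6 ≤ n → 2 ∣ n → 1 ≤ regularCount n
regularCount-positive 6≤n (divides 0 refl) with () ← 6≤n
regularCount-positive 6≤n (divides 1 refl) with s≤s (s≤s ()) ← 6≤n
regularCount-positive 6≤n (divides 2 refl) with s≤s (s≤s (s≤s (s≤s ()))) ← 6≤n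
regularCount-positive 6≤n (divides (suc (suc (suc m))) refl) =
  let M , reg = regularMatrix m in
  ≤-trans (𝟙-does-yes (is5Regular? M) reg) (∑-∈ (λ M → 𝟙 (does (is5Regular? M)))
      (∈-allVecs ∈-allSubsets M))

-- Random regular graphs

∑-filter : ∀ {P : A → Set} (P? : Decidable P) xs f →
           ∑ (filter P? xs) f ≡ ∑ xs (λ x → 𝟙 (does (P? x)) * f x)
∑-filter P? []       f = refl
∑-filter P? (x ∷ xs) f with does (P? x)
... | true  = cong₂ _+_ (sym (+-identityʳ (f x))) (∑-filter P? xs f)
... | false = ∑-filter P? xs f

∑-mapMaybe : ∀ (g : A → Maybe B) xs f → ∑ (mapMaybe g xs) f ≡ ∑ xs (λ x → maybe f 0 (g x))
∑-mapMaybe g []       f = refl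
∑-mapMaybe g (x ∷ xs) f with g x
... | just y  = cong (f y +_) (∑-mapMaybe g xs f)
... | nothing = ∑-mapMaybe g xs f

module _ {M : AdjMatrix n} where
  simple⇒5regular : (s : IsSymmetric M) (l : IsLoopless M) → Regular 5 (mkGraph M s l) → Is5Regular M
  simple⇒5regular s l reg = mk5Regular sym-entry (λ x → Bool.¬-not λ xx → l x (lookup⇒[]= x _ xx)) reg
    where
    sym-entry : Symmetric M
    sym-entry x y with entry M x y in xy | entry M y x in yx
    ... | true  | true  = refl
    ... | false | false = refl
    ... | true  | false = contradiction (trans (sym yx) ([]=⇒lookup (s x y (lookup⇒[]= y _ xy)))) λ ()
    ... | false | true  = contradiction (trans (sym xy) ([]=⇒lookup (s y x (lookup⇒[]= x _ yx)))) λ ()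

  5regular⇒symmetric : Is5Regular M → IsSymmetric M
  5regular⇒symmetric reg u v v∈ = lookup⇒[]= u _ (trans (Is5Regular.symm reg v u) ([]=⇒lookup v∈))

  5regular⇒loopless : Is5Regular M → IsLoopless M
  5regular⇒loopless reg v v∈ = contradiction (trans (sym ([]=⇒lookup v∈)) (Is5Regular.loopl reg v))
      λ ()

-- The bridge from `Graph` records, which contain proofs, to bare matrices, on which flips act.
∑-regularGraphs : ∀ n (F : AdjMatrix n → ℕ) →
  ∑ (regularGraphs 5 n) (F ∘ matrix) ≡ ∑ (matrices n) (λ M → 𝟙 (does (is5Regular? M)) * F M)
∑-regularGraphs n F = trans (∑-filter (regular? 5) (allGraphs n) (F ∘ matrix))
  (trans (∑-mapMaybe _ (matrices n) weight) (∑-cong (matrices n) (λ M → per-matrix M (isSimple? M))))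
  where
  weight : Graph n → ℕ
  weight G = 𝟙 (does (regular? 5 G)) * F (matrix G)
  -- Generalising over the decision lets the case split evaluate the conversion to a graph.
  per-matrix : ∀ M (d : Dec (IsSymmetric M × IsLoopless M)) →
    maybe weight 0 (mapᴹ (uncurry (mkGraph M)) (dec⇒maybe d)) ≡ 𝟙 (does (is5Regular? M)) * F M
  per-matrix M (yes (s , l)) = cong (λ b → 𝟙 b * F M)
    (does-⇔ (mk⇔ (simple⇒5regular s l) Is5Regular.degree≡5) (regular? 5 (mkGraph M s l))
        (is5Regular? M))
  per-matrix M (no ¬sl) = sym (cong (λ b → 𝟙 b * F M)
    (dec-false (is5Regular? M) λ reg → ¬sl (5regular⇒symmetric reg , 5regular⇒loopless reg)))

length-regularGraphs : ∀ n → length (regularGraphs 5 n) ≡ regularCount n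
length-regularGraphs n = trans (sym (trans (∑-const (regularGraphs 5 n) 1) (*-identityʳ _)))
  (trans (∑-regularGraphs n (λ _ → 1)) (∑-cong (matrices n) (λ M → *-identityʳ _)))

Dominated? : (G : Graph n) → Dec (11 * γₜ G ≤ 4 * n)
Dominated? {n} G = 11 * γₜ G ≤? 4 * n

exceptions : ∀ n → ℕ
exceptions n = count (λ G → not (does (Dominated? G))) (regularGraphs 5 n)

-- If `11 * γₜ G` exceeds `4 * n`, then 100 `n` is below 99 `n` plus the cycle term of `γₜ-bound`.
-- The difference of one `n` forces linearly many short cycles.
exceptional-cycles : ∀ {K} → 15 ≤ K → (G : Graph n) → Regular 5 G →
  n * 𝟙 (not (does (Dominated? G))) ≤ 11 * (50 * 6 ^ K) * shortCycles K (matrix G)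
exceptional-cycles {n} {K} 15≤K G reg = by-cases (Dominated? G)
  where
  open ≤-Reasoning
  S C : ℕ
  S = shortCycles K (matrix G)
  C = 50 * 6 ^ K
  by-cases : (d : Dec (11 * γₜ G ≤ 4 * n)) → n * 𝟙 (not (does d)) ≤ 11 * C * S
  by-cases (yes _) = ≤-trans (≤-reflexive (*-zeroʳ n)) z≤n
  by-cases (no ¬≤) = +-cancelˡ-≤ (99 * n) _ _ (begin
    99 * n + n * 1          ≡⟨ lem₁ n ⟩
    25 * (4 * n)            ≤⟨ *-monoʳ-≤ 25 (<⇒≤ (≰⇒> ¬≤)) ⟩
    25 * (11 * γₜ G)        ≡⟨ lem₂ (γₜ G) ⟩
    11 * (25 * γₜ G)        ≤⟨ *-monoʳ-≤ 11 (Unfolding.γₜ-bound G reg 15≤K) ⟩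
    11 * (9 * n + C * S)    ≡⟨ lem₃ n C S ⟩
    99 * n + 11 * C * S     ∎)
    where
    lem₁ : ∀ n → 99 * n + n * 1 ≡ 25 * (4 * n)
    lem₁ = solve-∀
    lem₂ : ∀ g → 25 * (11 * g) ≡ 11 * (25 * g)
    lem₂ = solve-∀
    lem₃ : ∀ n c s → 11 * (9 * n + c * s) ≡ 99 * n + 11 * c * s
    lem₃ = solve-∀

-- Independent of `n`, so that the exceptional graphs make up a fraction of order 1/`n`.
rarity : ℕ → ℕ
rarity K = 11 * (50 * 6 ^ K) * ∑ (upTo (suc K)) (λ k → 5 ^ k * 25)

exceptions-rare : ∀ {K} → 15 ≤ K → 5 * K + 60 ≤ n → n * exceptions n ≤ rarity K * regularCount n
exceptions-rare {n} {K} 15≤K large = begin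
  n * exceptions n                                          ≡⟨ ∑-*ˡ Gs n _ ⟨
  ∑ Gs (λ G → n * 𝟙 (not (does (Dominated? G))))
      ≤⟨ ∑-mono-∈ Gs (λ {G} G∈ → exceptional-cycles 15≤K G
      (proj₂ (∈-filter⁻ (regular? 5) {xs = allGraphs n} G∈))) ⟩
  ∑ Gs (λ G → c * shortCycles K (matrix G))                 ≡⟨ ∑-*ˡ Gs c _ ⟩
  c * ∑ Gs (shortCycles K ∘ matrix)
      ≡⟨ cong (c *_) (∑-regularGraphs n (shortCycles K)) ⟩
  c * ∑ (matrices n) (λ M → 𝟙 (does (is5Regular? M)) * shortCycles K M)
      ≤⟨ *-monoʳ-≤ c (∑-shortCycles K large) ⟩
  c * (∑ (upTo (suc K)) (λ k → 5 ^ k * 25) * regularCount n)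
      ≡⟨ *-assoc c (∑ (upTo (suc K)) (λ k → 5 ^ k * 25)) (regularCount n) ⟨
  rarity K * regularCount n                                 ∎
  where
  open ≤-Reasoning
  Gs = regularGraphs 5 n
  c = 11 * (50 * 6 ^ K)

length-filter-+ : ∀ {P : A → Set} (P? : Decidable P) xs →
                  length (filter P? xs) + count (λ x → not (does (P? x))) xs ≡ length xs
length-filter-+ P? []       = refl
length-filter-+ P? (x ∷ xs) with does (P? x)
... | true  = cong suc (length-filter-+ P? xs)
... | false = trans (+-suc _ _) (cong suc (length-filter-+ P? xs))

ι-denominator : ∀ q a d-1 → ℚ.toℚᵘ q ℚᵘ.≃ ℚᵘ.mkℚᵘ (ℤ.+ a) d-1 → ι (suc d-1) ℚ.* q ≡ ι a
ι-denominator q a d-1 q≃ = ℚ.toℚᵘ-injective (begin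
  ℚ.toℚᵘ (ι (suc d-1) ℚ.* q)                                   ≈⟨ ℚ.toℚᵘ-homo-* (ι (suc d-1)) q ⟩
  ℚ.toℚᵘ (ι (suc d-1)) ℚᵘ.* ℚ.toℚᵘ q                           ≈⟨ ℚᵘ.*-cong (toℚᵘ-ι (suc d-1)) q≃ ⟩
  ℚᵘ.mkℚᵘ (ℤ.+ suc d-1) 0 ℚᵘ.* ℚᵘ.mkℚᵘ (ℤ.+ a) d-1
      ≈⟨ ℚᵘ.*≡* (trans (ℤ.*-identityʳ (ℤ.+ suc d-1 ℤ.* ℤ.+ a))
           (trans (ℤ.*-comm (ℤ.+ suc d-1) (ℤ.+ a))
             (cong (λ k → ℤ.+ a ℤ.* ℤ.+ suc k) (sym (+-identityʳ d-1))))) ⟩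
  ℚᵘ.mkℚᵘ (ℤ.+ a) 0                                            ≈⟨ toℚᵘ-ι a ⟨
  ℚ.toℚᵘ (ι a)                                                 ∎)
  where open ≈-Reasoning ℚᵘ.≃-setoid

uniformProb-length : ∀ (xs : List A) {P : A → Set} (P? : Decidable P) → 1 ≤ length xs →
                     ι (length xs) ℚ.* uniformProb xs P? ≡ ι (length (filter P? xs))
uniformProb-length xs@(_ ∷ xs′) P? _ = ι-denominator _ (length (filter P? xs)) (length xs′)
    (ℚ.toℚᵘ-fromℚᵘ _)

ι-mono-< : ∀ {a b} → a < b → ι a ℚ.< ι b
ι-mono-< a<b = ℚ.≰⇒> λ ιb≤ιa → <⇒≱ a<b (ι-cancel-≤ ιb≤ιa)

-- Here `g` of `t` entries are good, `b` are bad, and ε is `suc e` over `d`. The distance from 1 is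
-- `b` over `t`, which is less than 1 over `d` and so less than ε.
near-one : ∀ {q ε g b t d e} → ι t ℚ.* q ≡ ι g → g + b ≡ t → ι d ℚ.* ε ≡ ι (suc e) → d * b < t →
           ℚ.∣ q ℚ.- 1ℚ ∣ ℚ.< ε
near-one {q} {ε} {g} {b} {t} {d} {e} tq≡g g+b≡t dε≡ db<t = subst (ℚ._< ε) (sym abs)
    (ℚ.*-cancelˡ-<-nonNeg (ι (d * t)) {{ℚ.nonNegative (ι-mono (z≤n {d * t}))}} (begin-strict
  ι (d * t) ℚ.* (1ℚ ℚ.- q)        ≡⟨ cong (ℚ._* (1ℚ ℚ.- q)) (ι-* d t) ⟩
  ι d ℚ.* ι t ℚ.* (1ℚ ℚ.- q)      ≡⟨ ℚ.*-assoc (ι d) (ι t) _ ⟩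
  ι d ℚ.* (ι t ℚ.* (1ℚ ℚ.- q))    ≡⟨ cong (ι d ℚ.*_) complement ⟩
  ι d ℚ.* ι b                     ≡⟨ ι-* d b ⟨
  ι (d * b)                       <⟨ ι-mono-< (<-≤-trans db<t (m≤m*n t (suc e))) ⟩
  ι (t * suc e)                   ≡⟨ ι-* t (suc e) ⟩
  ι t ℚ.* ι (suc e)               ≡⟨ cong (ι t ℚ.*_) dε≡ ⟨
  ι t ℚ.* (ι d ℚ.* ε)             ≡⟨ solve 3 (λ t d ε → t :* (d :* ε) := (d :* t) :* ε) refl (ι t)
      (ι d) ε ⟩
  ι d ℚ.* ι t ℚ.* ε               ≡⟨ cong (ℚ._* ε) (ι-* d t) ⟨
  ι (d * t) ℚ.* ε                 ∎))
  where
  open ℚ.≤-Reasoning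
  open +-*-Solver
  complement : ι t ℚ.* (1ℚ ℚ.- q) ≡ ι b
  complement = trans (solve 2 (λ t q → t :* (con 1ℚ :- q) := t :- t :* q) refl (ι t) q)
    (trans (cong₂ ℚ._-_ (trans (cong ι (sym g+b≡t)) (ι-+ g b)) tq≡g)
      (solve 2 (λ g b → (g :+ b) :- g := b) refl (ι g) (ι b)))
  0≤1-q : 0ℚ ℚ.≤ 1ℚ ℚ.- q
  0≤1-q = ℚ.*-cancelˡ-≤-pos (ι t) {{ℚ.positive (ι-mono-< (≤-<-trans z≤n db<t))}} (begin
    ι t ℚ.* 0ℚ          ≡⟨ ℚ.*-zeroʳ (ι t) ⟩
    0ℚ                  ≤⟨ ι-mono (z≤n {b}) ⟩
    ι b                 ≡⟨ complement ⟨
    ι t ℚ.* (1ℚ ℚ.- q)  ∎)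
  abs : ℚ.∣ q ℚ.- 1ℚ ∣ ≡ 1ℚ ℚ.- q
  abs = trans (cong ℚ.∣_∣ (solve 1 (λ q → q :- con 1ℚ := :- (con 1ℚ :- q)) refl q))
    (trans (ℚ.∣-p∣≡∣p∣ (1ℚ ℚ.- q)) (ℚ.0≤p⇒∣p∣≡p 0≤1-q))

reciprocal-bound : ∀ ε → 0ℚ ℚ.< ε → ∃[ d ] ∃[ e ] ι d ℚ.* ε ≡ ι (suc e)
reciprocal-bound (mkℚ (ℤ.+ suc e) d-1 c) 0<ε = suc d-1 , e , ι-denominator (mkℚ (ℤ.+ suc e) d-1 c)
    (suc e) d-1 ℚᵘ.≃-refl
reciprocal-bound (mkℚ (ℤ.+ zero) d-1 c) (ℚ.*<* 0<0) = contradiction 0<0 (ℤ.<-irrefl refl)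
reciprocal-bound (mkℚ ℤ.-[1+ e ] d-1 c) (ℚ.*<* ())

dominated-aas : ∀ {K} → 15 ≤ K →
  (λ n → uniformProb (regularGraphs 5 n) (λ G → 11 * γₜ G ≤? 4 * n)) ⟶ᵉᵛᵉⁿ 1ℚ
dominated-aas {K} 15≤K ε 0<ε = let d , e , dε≡ = reciprocal-bound ε 0<ε in
  -- The first summand makes the exceptional fraction smaller than 1 over `d`; the second provides
  -- the room for switchings and ensures that regular graphs exist.
  suc (rarity K * d) + (5 * K + 60) , λ n n≥ even → conclude d e dε≡ n n≥ even
  where
  conclude : ∀ d e → ι d ℚ.* ε ≡ ι (suc e) → ∀ n → n ≥ suc (rarity K * d) + (5 * K + 60) → 2 ∣ n →
    ℚ.∣ uniformProb (regularGraphs 5 n) Dominated? ℚ.- 1ℚ ∣ ℚ.< ε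
  conclude d e dε≡ n n≥ even = near-one {d = d} {e} (uniformProb-length Gs Dominated? 1≤t)
      (length-filter-+ Dominated? Gs) dε≡
    (*-cancelˡ-< n _ _ (begin-strict
      n * (d * exceptions n)            ≡⟨ lem₁ n d (exceptions n) ⟩
      d * (n * exceptions n)            ≤⟨ *-monoʳ-≤ d (exceptions-rare 15≤K large) ⟩
      d * (rarity K * regularCount n)   ≡⟨ cong (λ t → d * (rarity K * t)) (length-regularGraphs n) ⟨
      d * (rarity K * length Gs)        ≡⟨ lem₂ d (rarity K) (length Gs) ⟩
      rarity K * d * length Gs          <⟨ *-monoˡ-< (length Gs) {{>-nonZero 1≤t}}
          (≤-trans (m≤m+n (suc (rarity K * d)) _) n≥) ⟩
      n * length Gs                     ∎))
    where
    open ≤-Reasoning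
    Gs = regularGraphs 5 n
    large : 5 * K + 60 ≤ n
    large = ≤-trans (m≤n+m (5 * K + 60) (suc (rarity K * d))) n≥
    1≤t : 1 ≤ length Gs
    1≤t = subst (1 ≤_) (sym (length-regularGraphs n))
      (regularCount-positive (≤-trans (≤ᵇ⇒≤ 6 60 tt) (≤-trans (m≤n+m 60 (5 * K)) large)) even)
    lem₁ : ∀ n d b → n * (d * b) ≡ d * (n * b)
    lem₁ = solve-∀
    lem₂ : ∀ d r t → d * (r * t) ≡ r * d * t
    lem₂ = solve-∀

mainTheorem3 : (∃[ g₀ ] ∀ (n : ℕ) (G : Graph n) → Regular 5 G → GirthAtLeast G g₀ → 11 * γₜ G ≤ 4 * n)
    × ((λ n → uniformProb (regularGraphs 5 n) (λ G → 11 * γₜ G ≤? 4 * n)) ⟶ᵉᵛᵉⁿ 1ℚ)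
-- The girth 17 is `2 + K` for `K` equal to 15, the radius that three rounds require.
mainTheorem3 = (17 , λ n → γₜ-girth (≤-refl {15})) , dominated-aas (≤-refl {15})
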